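{- Let $G$ be a finite simple connected graph with minimum degree $\delta$ and maximum degree $\Delta$. If $\delta \geq 2$, then $D'(G)\leq \lceil \sqrt[\delta]{\Delta}\,\rceil + 1$.
   Context: The distinguishing index $D'(G)$ of a graph $G$ is the least number $d$ such that $G$ has an edge labeling with $d$ labels (an arbitrary map from $E(G)$ to a set of $d$ labels, not necessarily a proper edge colouring) that is preserved only by the identity automorphism of $G$. An automorphism $\varphi$ of $G$ preserves an edge labeling $c$ if $c(\varphi(u)\varphi(w)) = c(uw)$ for every edge $uw\in E(G)$. Here $\sqrt[\delta]{\Delta}=\Delta^{1/\delta}$. -}

module Defs where

open import Data.Fin using (Fin)
open import Data.Fin.Permutation using (Permutation′; _⟨$⟩ʳ_)
open import Data.List using (length; filter; allFin)
open import Data.Nat using (ℕ; _≤_; _^_)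
open import Data.Product using (_×_; ∃-syntax; Σ-syntax)
open import Level using (0ℓ)
open import Relation.Binary.Construct.Closure.ReflexiveTransitive using (Star)
open import Relation.Binary.Core using (Rel)
open import Relation.Binary.Definitions using (Decidable; Symmetric)
open import Relation.Binary.PropositionalEquality using (_≡_)
open import Relation.Nullary using (¬_)

IsLeast : (ℕ → Set) → ℕ → Set
IsLeast P m = P m × (∀ k → P k → m ≤ k)

IsGreatest : (ℕ → Set) → ℕ → Set
IsGreatest P m = P m × (∀ k → P k → k ≤ m)

record Graph (n : ℕ) : Set₁ where
  field
    _~_      : Rel (Fin n) 0ℓ
    _~?_     : Decidable _~_
    ~-sym    : Symmetric _~_
    ~-irrefl : ∀ v → ¬ (v ~ v)

module _ {n : ℕ} (G : Graph n) where
  open Graph G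

  -- The null graph is not excluded here; it has no minimum degree in the
  -- sense of IsMinDegree.
  Connected : Set
  Connected = ∀ u v → Star _~_ u v

  degree : Fin n → ℕ
  degree v = length (filter (v ~?_) (allFin n))

  IsMinDegree : ℕ → Set
  IsMinDegree = IsLeast (λ k → ∃[ v ] degree v ≡ k)

  IsMaxDegree : ℕ → Set
  IsMaxDegree = IsGreatest (λ k → ∃[ v ] degree v ≡ k)

  record Automorphism : Set where
    field
      perm     : Permutation′ n
      preserve : ∀ {u v} → u ~ v → (perm ⟨$⟩ʳ u) ~ (perm ⟨$⟩ʳ v)
      reflect  : ∀ {u v} → (perm ⟨$⟩ʳ u) ~ (perm ⟨$⟩ʳ v) → u ~ v

  -- A map from E(G) to d labels is a map on ordered adjacent pairs that does
  -- not depend on the orientation; the adjacency proof is irrelevant, so each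
  -- edge gets a single label.
  record EdgeLabeling (d : ℕ) : Set where
    field
      label     : ∀ u v → .(u ~ v) → Fin d
      label-sym : ∀ u v (e : u ~ v) → label u v e ≡ label v u (~-sym e)

  Preserves : ∀ {d} → Automorphism → EdgeLabeling d → Set
  Preserves φ c = ∀ u v (e : u ~ v) →
    label (perm ⟨$⟩ʳ u) (perm ⟨$⟩ʳ v) (preserve e) ≡ label u v e
    where open Automorphism φ
          open EdgeLabeling c

  IsIdentity : Automorphism → Set
  IsIdentity φ = ∀ v → Automorphism.perm φ ⟨$⟩ʳ v ≡ v

  Distinguishing : ∀ {d} → EdgeLabeling d → Set
  Distinguishing c = ∀ φ → Preserves φ c → IsIdentity φ

  IsDistinguishingIndex : ℕ → Set
  IsDistinguishingIndex = IsLeast (λ d → Σ[ c ∈ EdgeLabeling d ] Distinguishing c)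

-- IsCeilRoot r x k says k = ⌈ x^(1/r) ⌉ for r ≥ 1: the ceiling is the least
-- integer k with x^(1/r) ≤ k, that is, with x ≤ k^r (a negative k never does,
-- as x^(1/r) ≥ 0).
IsCeilRoot : (r x : ℕ) → ℕ → Set
IsCeilRoot r x = IsLeast (λ k → x ≤ k ^ r)

{-# OPTIONS --safe #-}

-- Let k = ⌈Δ^(1/δ)⌉ and N = k^δ ≥ Δ; the colours are 0, …, k.  Take a
-- depth-first search tree whose root is an end of a longest path of G and which
-- contains that path as a root path.  Every edge joins a vertex to an ancestor,
-- so a leaf has at least δ neighbours, all of them ancestors, linearly ordered
-- by depth.  Give each vertex a code in {0, …, N-1}: the m children of a vertex
-- with code q get q, q+1, …, q+m-1 modulo N.  Tree edges ending in an inner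
-- vertex get colour 0, the remaining edges between inner vertices get 1, and
-- the edges from a leaf to its ancestors spell out the base-k digits of its
-- code, shifted by one.
--
-- An automorphism that preserves the colours and fixes the root preserves the
-- tree.  It preserves codes, from the leaves upwards, since m < N makes
-- a cyclic interval determine its start; siblings having different codes, it is
-- the identity.
--
-- The inner vertices form the tree of 0-edges.  If an automorphism moves the
-- root, it sends every inner vertex z of maximal depth to the root, because the
-- image of the root path of z could otherwise be prolonged at both ends beyond
-- the longest path.  Hence z is unique and is swapped with the root.  In that
-- case the children of z are recoded in two ways that differ in the colour
-- of a single edge at z, so that for one of the two the numbers of 1-edges at
-- z and at the root differ.
module Submission where

open import Data.Fin using (Fin; zero; suc; fromℕ<; toℕ)
open import Data.Fin.Permutation using (permutation; _⟨$⟩ʳ_; _⟨$⟩ˡ_; inverseʳ; inverseˡ)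
open import Data.Fin.Properties using (any?; all?; _≟_; toℕ-fromℕ<; toℕ-injective)
open import Data.List using (List; []; _∷_; _++_; _∷ʳ_; _ʳ++_; length; filter; allFin; map; reverse)
open import Data.List.Membership.DecPropositional using () renaming (_∈?_ to ∈-dec)
open import Data.List.Membership.Propositional using (_∈_; _∉_; lose)
open import Data.List.Membership.Propositional.Properties using (∈-∃++; ∈-++⁻; ∈-++⁺ˡ; ∈-++⁺ʳ;
  ∈-allFin; ∈-filter⁺; ∈-filter⁻; ∈-map⁻)
open import Data.List.Properties using (∷-injective; ∷-injectiveˡ; ≡-dec; filter-accept;
  filter-reject; filter-none; filter-notAll; filter-≐; length-++-sucʳ; length-filter; length-map;
  length-reverse; length-tabulate; map-++; reverse-++)
open import Data.List.Relation.Unary.All as All using (All; []; _∷_)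
open import Data.List.Relation.Unary.AllPairs using ([]; _∷_)
open import Data.List.Relation.Unary.Any using (here; there)
open import Data.List.Relation.Unary.Linked as Linked using (Linked; []; [-]; _∷_; linked?)
open import Data.List.Relation.Unary.Unique.Propositional using (Unique)
import Data.List.Relation.Unary.Unique.DecPropositional as Unique
open import Data.List.Relation.Unary.Unique.Propositional.Properties as Unique using
  (Unique[x∷xs]⇒x∉xs)
open import Data.Nat as ℕ using (ℕ; zero; suc; _+_; _∸_; _*_; _^_; _≤_; _<_; z≤n; s≤s; s≤s⁻¹;
  NonZero; _≤?_; _<?_; >-nonZero; >-nonZero⁻¹)
open import Data.Nat.DivMod using (_/_; _%_; m≡m%n+[m/n]*n; m%n<n; m%n%n≡m%n; m<n⇒m%n≡m;
  m<n⇒m/n≡0; m<n*o⇒m/o<n; %-distribˡ-+)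
open import Data.Nat.Properties using (*-comm; +-assoc; +-cancelˡ-≡; +-comm; +-identityʳ; +-suc;
  <-asym; <-irrefl; <-trans; <⇒≤; <⇒≱; ^-identityʳ; ^-monoʳ-≤; ^-zeroˡ; m+[n∸m]≡n; m^n≢0;
  m∸n≡0⇒m≤n; m∸n≤m; m≤m+n; m≤n⇒m<n∨m≡n; n<1+n; suc-injective; ≤-<-trans; ≤-antisym; ≤-refl;
  ≤-reflexive; ≤-total; ≤-trans)
open import Data.Product using (_×_; _,_; proj₁; proj₂; ∃; ∃-syntax; Σ-syntax)
open import Data.Sum using (_⊎_; inj₁; inj₂; swap)
open import Data.Vec as Vec using (Vec; []; _∷_; lookup; tabulate; toList; fromList)
open import Data.Vec.Properties using (length-toList; lookup∘tabulate; toList∘fromList)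
open import Function using (_∘_; id)
open import Relation.Binary.Construct.Closure.ReflexiveTransitive using (Star; _◅_) renaming (ε to
  ε⋆)
open import Relation.Binary.PropositionalEquality using (_≡_; _≢_; refl; sym; trans; cong; cong₂;
  subst; subst₂; module ≡-Reasoning)
open import Relation.Nullary using (¬_; Dec; yes; no; contradiction)
open import Relation.Nullary.Decidable using (map′; _×-dec_; _→-dec_; ¬?; decidable-stable)
open import Relation.Unary using (Decidable)
open import Defs

-- Decidability of the existence of a distinguishing labeling

-- Exhaustive search, in a form that passes from `A` to vectors over `A` and hence to tables of
-- functions.
Searchable : Set → Set₁
Searchable A = ∀ {P : A → Set} → Decidable P → Dec (∃ P)

search-Vec : ∀ {A} → Searchable A → ∀ m → Searchable (Vec A m)
search-Vec s zero P? = map′ ([] ,_) (λ { ([] , p) → p }) (P? [])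
search-Vec s (suc m) P? =
  map′ (λ { (x , xs , p) → (x ∷ xs) , p }) (λ { ((x ∷ xs) , p) → x , xs , p })
    (s (λ x → search-Vec s m (P? ∘ (x ∷_))))

-- If `P 0` fails, the least witness is one more than that of the shifted predicate. This yields
-- both the rounded root and the distinguishing index, the latter with its upper bound.
least-below : ∀ {P : ℕ → Set} → Decidable P → ∀ {m} → P m → ∃[ k ] (IsLeast P k × k ≤ m)
least-below {P} P? {zero} p = 0 , (p , λ _ _ → z≤n) , z≤n
least-below {P} P? {suc m} p with P? 0
... | yes p₀ = 0 , (p₀ , λ _ _ → z≤n) , z≤n
... | no ¬p₀ with k , (pk , k-least) , k≤m ← least-below (P? ∘ suc) p =
  suc k , (pk , suc-least) , s≤s k≤m
  where
  suc-least : ∀ l → P l → suc k ≤ l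
  suc-least zero    pl = contradiction pl ¬p₀
  suc-least (suc l) pl = s≤s (k-least l pl)

module _ {n : ℕ} (G : Graph n) where
  open Graph G

  -- A pair of mutually inverse functions, so that automorphisms can be sought among pairs of
  -- vectors; that `f` reflects adjacency is expressed by `g` preserving it.
  record ColourAut {C : Set} (col : Fin n → Fin n → C) (f g : Fin n → Fin n) : Set where
    field
      fg      : ∀ v → f (g v) ≡ v
      gf      : ∀ v → g (f v) ≡ v
      f-edge  : ∀ u v → u ~ v → f u ~ f v
      g-edge  : ∀ u v → u ~ v → g u ~ g v
      f-col   : ∀ u v → u ~ v → col (f u) (f v) ≡ col u v

  Rigid : ∀ {C : Set} → (Fin n → Fin n → C) → Set
  Rigid col = ∀ f g → ColourAut col f g → ∀ v → f v ≡ v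

  EdgeSymmetric : ∀ {C : Set} → (Fin n → Fin n → C) → Set
  EdgeSymmetric col = ∀ u v → u ~ v → col u v ≡ col v u

  ColourAut-inverse : ∀ {C} {col : Fin n → Fin n → C} {f g} → ColourAut col f g → ColourAut col g f
  ColourAut-inverse {col = col} {f} {g} φ = record
    { fg = gf ; gf = fg ; f-edge = g-edge ; g-edge = f-edge
    ; f-col = λ u v e → trans (sym (f-col _ _ (g-edge u v e))) (cong₂ col (fg u) (fg v)) }
    where open ColourAut φ

  ColourAut-cong : ∀ {C} {col : Fin n → Fin n → C} {f f′ g g′} →
    (∀ v → f v ≡ f′ v) → (∀ v → g v ≡ g′ v) → ColourAut col f g → ColourAut col f′ g′
  ColourAut-cong {col = col} {f} {f′} {g} {g′} f≗ g≗ φ = record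
    { fg = λ v → trans (sym (trans (f≗ (g v)) (cong f′ (g≗ v)))) (fg v)
    ; gf = λ v → trans (sym (trans (g≗ (f v)) (cong g′ (f≗ v)))) (gf v)
    ; f-edge = λ u v e → subst₂ _~_ (f≗ u) (f≗ v) (f-edge u v e)
    ; g-edge = λ u v e → subst₂ _~_ (g≗ u) (g≗ v) (g-edge u v e)
    ; f-col = λ u v e → trans (sym (cong₂ col (f≗ u) (f≗ v))) (f-col u v e) }
    where open ColourAut φ

  -- Lets rigidity pass from `col′` to `col`, for instance from a colouring to its table, or from
  -- colours in `ℕ` to colours in `Fin`.
  ColourAut-recolour : ∀ {C D} {col : Fin n → Fin n → C} {col′ : Fin n → Fin n → D} {f g} →
    (∀ {u v u′ v′} → col u v ≡ col u′ v′ → col′ u v ≡ col′ u′ v′) →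
    ColourAut col f g → ColourAut col′ f g
  ColourAut-recolour coarser φ = record
    { fg = fg ; gf = gf ; f-edge = f-edge ; g-edge = g-edge
    ; f-col = λ u v e → coarser (f-col u v e) }
    where open ColourAut φ

  module _ {d : ℕ} (col : Fin n → Fin n → Fin d) where

    ColourAut? : ∀ f g → Dec (ColourAut col f g)
    ColourAut? f g = map′
      (λ { (a , b , c , d , e) → record { fg = a ; gf = b ; f-edge = c ; g-edge = d ; f-col = e } })
      (λ φ → let open ColourAut φ in fg , gf , f-edge , g-edge , f-col)
      (all? (λ v → f (g v) ≟ v) ×-dec all? (λ v → g (f v) ≟ v)
        ×-dec all? (λ u → all? λ v → (u ~? v) →-dec (f u ~? f v))
        ×-dec all? (λ u → all? λ v → (u ~? v) →-dec (g u ~? g v))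
        ×-dec all? (λ u → all? λ v → (u ~? v) →-dec (col (f u) (f v) ≟ col u v)))

    -- Rigidity fails exactly when some pair of vectors describes a colour-preserving automorphism
    -- that moves a vertex; tabulating `f` and `g` loses nothing.
    Rigid? : Dec (Rigid col)
    Rigid? = map′ to from (¬? (search-Vec any? n λ f → search-Vec any? n λ g → moves? f g))
      where
      Moves : (f g : Vec (Fin n) n) → Set
      Moves f g = ColourAut col (lookup f) (lookup g) × ∃[ v ] lookup f v ≢ v

      moves? : ∀ f g → Dec (Moves f g)
      moves? f g = ColourAut? (lookup f) (lookup g) ×-dec any? (λ v → ¬? (lookup f v ≟ v))

      to : ¬ (∃[ f ] ∃[ g ] Moves f g) → Rigid col
      to ¬moves f g φ v = decidable-stable (f v ≟ v) λ fv≢v → ¬moves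
        ( tabulate f , tabulate g
        , ColourAut-cong (sym ∘ lookup∘tabulate f) (sym ∘ lookup∘tabulate g) φ
        , v , fv≢v ∘ trans (sym (lookup∘tabulate f v)))

      from : Rigid col → ¬ (∃[ f ] ∃[ g ] Moves f g)
      from rigid (f , g , φ , v , fv≢v) = fv≢v (rigid (lookup f) (lookup g) φ v)

    EdgeSymmetric? : Dec (EdgeSymmetric col)
    EdgeSymmetric? = all? λ u → all? λ v → (u ~? v) →-dec (col u v ≟ col v u)

  fromColouring : ∀ {d} (col : Fin n → Fin n → Fin d) → EdgeSymmetric col → Rigid col →
    Σ[ c ∈ EdgeLabeling G d ] Distinguishing G c
  fromColouring col col-sym rigid =
    record { label = λ u v _ → col u v ; label-sym = col-sym } ,
    λ φ pres → let open Automorphism φ in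
      rigid (perm ⟨$⟩ʳ_) (perm ⟨$⟩ˡ_) record
        { fg = λ _ → inverseʳ perm ; gf = λ _ → inverseˡ perm
        ; f-edge = λ _ _ → preserve
        ; g-edge = λ u v e → reflect (subst₂ _~_ (sym (inverseʳ perm)) (sym (inverseʳ perm)) e)
        ; f-col = pres }

  toColouring : ∀ {d} → Σ[ c ∈ EdgeLabeling G (suc d) ] Distinguishing G c →
    Σ[ col ∈ (Fin n → Fin n → Fin (suc d)) ] EdgeSymmetric col × Rigid col
  toColouring {d} (c , dist) = col , col-sym , rigid
    where
    open EdgeLabeling c

    col : Fin n → Fin n → Fin (suc d)
    col u v with u ~? v
    ... | yes e = label u v e
    -- A default colour off the edges, available because there are `suc d` labels.
    ... | no  _ = zero

    col≡label : ∀ u v (e : u ~ v) → col u v ≡ label u v e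
    col≡label u v e with u ~? v
    ... | yes _  = refl
    ... | no ¬e = contradiction e ¬e

    col-sym : EdgeSymmetric col
    col-sym u v e = trans (col≡label u v e) (trans (label-sym u v e) (sym (col≡label v u (~-sym e))))

    rigid : Rigid col
    rigid f g φ = dist
      record { perm = permutation f g fg gf
             ; preserve = f-edge _ _
             ; reflect = λ e → subst₂ _~_ (gf _) (gf _) (g-edge _ _ e) }
      λ u v e → trans (sym (col≡label (f u) (f v) (f-edge u v e))) (trans (f-col u v e) (col≡label u v e))
      where open ColourAut φ

  -- The given edge rules out a labeling with no labels. Otherwise the finitely many colour tables
  -- are searched.
  Distinguishable? : ∀ {u v} → u ~ v → Decidable (λ d → Σ[ c ∈ EdgeLabeling G d ] Distinguishing G c)
  Distinguishable? u~v zero = no λ (c , _) → case0 (EdgeLabeling.label c _ _ u~v)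
    where
    case0 : ¬ Fin 0
    case0 ()
  Distinguishable? u~v (suc d) = map′ to from
    (search-Vec (search-Vec any? n) n λ t → EdgeSymmetric? (table t) ×-dec Rigid? (table t))
    where
    table : Vec (Vec (Fin (suc d)) n) n → Fin n → Fin n → Fin (suc d)
    table t u v = lookup (lookup t u) v

    to : ∃[ t ] (EdgeSymmetric (table t) × Rigid (table t)) → Σ[ c ∈ EdgeLabeling G (suc d) ] Distinguishing G c
    to (t , s , r) = fromColouring (table t) s r

    from : Σ[ c ∈ EdgeLabeling G (suc d) ] Distinguishing G c → ∃[ t ] (EdgeSymmetric (table t) × Rigid (table t))
    from cd with col , col-sym , rigid ← toColouring cd =
      t , (λ u v e → trans (t≗ u v) (trans (col-sym u v e) (sym (t≗ v u)))) ,
      λ f g φ → rigid f g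
        (ColourAut-recolour (λ {u} {v} {u′} {v′} eq → trans (sym (t≗ u v)) (trans eq (t≗ u′ v′))) φ)
      where
      t : Vec (Vec (Fin (suc d)) n) n
      t = tabulate (tabulate ∘ col)

      t≗ : ∀ u v → table t u v ≡ col u v
      t≗ u v = trans (cong (λ row → lookup row v) (lookup∘tabulate (tabulate ∘ col) u)) (lookup∘tabulate (col u) v)

-- Lists without repetitions

module _ {A : Set} where

  -- The head of `xs` is cut out of `ys`; as it does not recur in `xs`, the tail stays inside the
  -- remainder.
  Unique-⊆⇒length≤ : ∀ {xs ys : List A} → Unique xs → (∀ {x} → x ∈ xs → x ∈ ys) → length xs ≤ length ys
  Unique-⊆⇒length≤ [] sub = z≤n
  Unique-⊆⇒length≤ {x ∷ xs} u@(_ ∷ uxs) sub with as , bs , refl ← ∈-∃++ (sub (here refl)) =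
    ≤-trans (s≤s (Unique-⊆⇒length≤ uxs sub′)) (≤-reflexive (sym (length-++-sucʳ as _ bs)))
    where
    sub′ : ∀ {y} → y ∈ xs → y ∈ as ++ bs
    sub′ y∈ with ∈-++⁻ as (sub (there y∈))
    ... | inj₁ y∈as = ∈-++⁺ˡ y∈as
    ... | inj₂ (here refl) = contradiction y∈ (Unique[x∷xs]⇒x∉xs u)
    ... | inj₂ (there y∈bs) = ∈-++⁺ʳ as y∈bs

  ∉⇒All≢ : ∀ {x : A} {xs} → x ∉ xs → All (x ≢_) xs
  ∉⇒All≢ x∉ = All.tabulate λ { y∈ refl → x∉ y∈ }

  Unique-ʳ++ : ∀ {xs ys : List A} → Unique xs → Unique ys → (∀ {x} → x ∈ xs → x ∉ ys) → Unique (xs ʳ++ ys)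
  Unique-ʳ++ [] uys disj = uys
  Unique-ʳ++ u@(_ ∷ uxs) uys disj =
    Unique-ʳ++ uxs (∉⇒All≢ (disj (here refl)) ∷ uys)
      λ { x∈ (here refl) → Unique[x∷xs]⇒x∉xs u x∈ ; x∈ (there x∈ys) → disj (there x∈) x∈ys }

  Linked-ʳ++ : ∀ {R : A → A → Set} → (∀ {x y} → R x y → R y x) →
    ∀ {x xs ys} → Linked R (x ∷ xs) → Linked R (x ∷ ys) → Linked R (xs ʳ++ (x ∷ ys))
  Linked-ʳ++ R-sym [-] l = l
  Linked-ʳ++ R-sym (r ∷ ls) l = Linked-ʳ++ R-sym ls (R-sym r ∷ l)

  Linked-reverse : ∀ {R : A → A → Set} → (∀ {x y} → R x y → R y x) →
    ∀ {xs} → Linked R xs → Linked R (reverse xs)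
  Linked-reverse R-sym [] = []
  Linked-reverse R-sym [-] = [-]
  Linked-reverse R-sym l@(_ ∷ _) = Linked-ʳ++ R-sym l [-]

  Unique-reverse : ∀ {xs : List A} → Unique xs → Unique (reverse xs)
  Unique-reverse u = Unique-ʳ++ u [] λ _ ()

-- Positions in a list and digit expansions

module _ {n : ℕ} where

  -- Junk value length xs when t ∉ xs.
  position : List (Fin n) → Fin n → ℕ
  position [] t = 0
  position (x ∷ xs) t with x ≟ t
  ... | yes _ = 0
  ... | no  _ = suc (position xs t)

  position<length : ∀ {xs t} → t ∈ xs → position xs t < length xs
  position<length {x ∷ xs} {t} t∈ with x ≟ t
  ... | yes _ = s≤s z≤n
  position<length {x ∷ xs} (here refl) | no x≢t = contradiction refl x≢t
  position<length {x ∷ xs} (there t∈) | no _ = s≤s (position<length t∈)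

  position-injective : ∀ {xs s t} → s ∈ xs → t ∈ xs → position xs s ≡ position xs t → s ≡ t
  position-injective {x ∷ xs} {s} {t} s∈ t∈ eq with x ≟ s | x ≟ t
  ... | yes refl | yes refl = refl
  position-injective (here refl) _ _ | no x≢s | no _ = contradiction refl x≢s
  position-injective _ (here refl) _ | no _ | no x≢t = contradiction refl x≢t
  position-injective (there s∈) (there t∈) eq | no _ | no _ = position-injective s∈ t∈ (suc-injective eq)

  position-surjective : ∀ {xs i} → Unique xs → i < length xs → ∃[ t ] (t ∈ xs × position xs t ≡ i)
  position-surjective {x ∷ xs} {zero} u i< = x , here refl , position-head
    where
    position-head : position (x ∷ xs) x ≡ 0
    position-head with x ≟ x
    ... | yes _ = refl
    ... | no x≢x = contradiction refl x≢x
  position-surjective {x ∷ xs} {suc i} u@(_ ∷ uxs) (s≤s i<)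
    with t , t∈ , eq ← position-surjective uxs i< = t , there t∈ , position-tail
    where
    position-tail : position (x ∷ xs) t ≡ suc i
    position-tail with x ≟ t
    ... | yes refl = contradiction t∈ (Unique[x∷xs]⇒x∉xs u)
    ... | no _ = cong suc eq

  module _ (b : ℕ) .{{_ : NonZero b}} where

    -- Assigns the base-b digits of q to the entries of xs, least significant
    -- first; junk value 0 when t ∉ xs.
    digitAt : ℕ → List (Fin n) → Fin n → ℕ
    digitAt q [] t = 0
    digitAt q (x ∷ xs) t with x ≟ t
    ... | yes _ = q % b
    ... | no  _ = digitAt (q / b) xs t

    digitAt-head : ∀ q x xs → digitAt q (x ∷ xs) x ≡ q % b
    digitAt-head q x xs with x ≟ x
    ... | yes _ = refl
    ... | no x≢x = contradiction refl x≢x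

    digitAt-tail : ∀ q {x} xs {t} → x ≢ t → digitAt q (x ∷ xs) t ≡ digitAt (q / b) xs t
    digitAt-tail q {x} xs {t} x≢t with x ≟ t
    ... | yes x≡t = contradiction x≡t x≢t
    ... | no _ = refl

    digitAt-map : ∀ {f : Fin n → Fin n} → (∀ {x y} → f x ≡ f y → x ≡ y) →
      ∀ q xs t → digitAt q (map f xs) (f t) ≡ digitAt q xs t
    digitAt-map inj q [] t = refl
    digitAt-map {f} inj q (x ∷ xs) t with x ≟ t | f x ≟ f t
    ... | yes _ | yes _ = refl
    ... | no _ | no _ = digitAt-map inj (q / b) xs t
    ... | yes x≡t | no fx≢ft = contradiction (cong f x≡t) fx≢ft
    ... | no x≢t | yes fx≡ft = contradiction (inj fx≡ft) x≢t

    -- The head of `xs` shows `q % b` and the tail shows the digits of `q / b`. Below `b ^ d` the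
    -- first `d` digits suffice, so `xs` may be longer.
    digits-determine : ∀ {d xs q q′} → Unique xs → d ≤ length xs → q < b ^ d → q′ < b ^ d →
      (∀ {t} → t ∈ xs → digitAt q xs t ≡ digitAt q′ xs t) → q ≡ q′
    digits-determine {zero} {q = zero} {zero} _ _ _ _ _ = refl
    digits-determine {zero} {q = suc _} _ _ (s≤s ()) _ _
    digits-determine {zero} {q′ = suc _} _ _ _ (s≤s ()) _
    digits-determine {suc d} {x ∷ xs} {q} {q′} u@(_ ∷ uxs) (s≤s d≤) q< q′< agree =
      trans (m≡m%n+[m/n]*n q b) (trans
        (cong₂ (λ h l → h + l * b) heads (digits-determine uxs d≤ (shift q<) (shift q′<) tails))
        (sym (m≡m%n+[m/n]*n q′ b)))
      where
      shift : ∀ {p} → p < b ^ suc d → p / b < b ^ d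
      shift {p} p< = m<n*o⇒m/o<n (subst (p <_) (*-comm b (b ^ d)) p<)

      heads : q % b ≡ q′ % b
      heads = trans (sym (digitAt-head q x xs)) (trans (agree (here refl)) (digitAt-head q′ x xs))

      tails : ∀ {t} → t ∈ xs → digitAt (q / b) xs t ≡ digitAt (q′ / b) xs t
      tails {t} t∈ = trans (sym (digitAt-tail q xs x≢t)) (trans (agree (there t∈)) (digitAt-tail q′ xs x≢t))
        where
        x≢t : x ≢ t
        x≢t refl = Unique[x∷xs]⇒x∉xs u t∈

module _ {n : ℕ} where

  _without_ : List (Fin n) → Fin n → List (Fin n)
  xs without u = filter (λ x → ¬? (x ≟ u)) xs

  ∉-without : ∀ xs {u x} → x ∉ xs without u → x ≡ u ⊎ x ∉ xs
  ∉-without xs {u} {x} x∉ with x ≟ u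
  ... | yes x≡u = inj₁ x≡u
  ... | no x≢u = inj₂ λ x∈ → x∉ (∈-filter⁺ (λ y → ¬? (y ≟ u)) x∈ x≢u)

  ∈-without : ∀ xs {u x} → x ∈ xs without u → x ∈ xs × x ≢ u
  ∈-without xs {u} = ∈-filter⁻ (λ y → ¬? (y ≟ u)) {xs = xs}

  _[_≔_] : (Fin n → List (Fin n)) → Fin n → List (Fin n) → Fin n → List (Fin n)
  (anc [ u ≔ s ]) x with x ≟ u
  ... | yes _ = s
  ... | no  _ = anc x

  ≔-same : ∀ anc u {s} → (anc [ u ≔ s ]) u ≡ s
  ≔-same anc u with u ≟ u
  ... | yes _ = refl
  ... | no u≢u = contradiction refl u≢u

  ≔-other : ∀ anc {u s x} → x ≢ u → (anc [ u ≔ s ]) x ≡ anc x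
  ≔-other anc {u} {x = x} x≢u with x ≟ u
  ... | yes x≡u = contradiction x≡u x≢u
  ... | no _ = refl

-- Longest paths and normal spanning trees

module _ {n : ℕ} (G : Graph n) where
  open Graph G

  Path : List (Fin n) → Set
  Path xs = Linked _~_ xs × Unique xs

  length-path≤ : ∀ {xs} → Path xs → length xs ≤ n
  length-path≤ {xs} (_ , u) =
    subst (length xs ≤_) (length-tabulate id) (Unique-⊆⇒length≤ u (λ {x} _ → ∈-allFin x))

  -- The bound `m` on path lengths is lowered from `n` until a search finds a path attaining it. The
  -- one-vertex path at `v` keeps the bound positive.
  longest-path : Fin n → ∃[ u ] ∃[ us ] (Path (u ∷ us) × (∀ xs → Path xs → length xs ≤ suc (length us)))
  longest-path v = below n λ xs → length-path≤
    where
    path? : ∀ xs → Dec (Path xs)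
    path? xs = linked? _~?_ xs ×-dec Unique.unique? _≟_ xs

    below : ∀ m → (∀ xs → Path xs → length xs ≤ m) →
      ∃[ u ] ∃[ us ] (Path (u ∷ us) × (∀ xs → Path xs → length xs ≤ suc (length us)))
    below zero bound with () ← bound (v ∷ []) ([-] , [] ∷ [])
    below (suc m) bound with search-Vec any? (suc m) (path? ∘ toList)
    ... | yes (u Vec.∷ us , p) = u , toList us , p ,
      λ xs q → subst (λ l → length xs ≤ suc l) (sym (length-toList us)) (bound xs q)
    ... | no ¬path = below m bound′
      where
      bound′ : ∀ xs → Path xs → length xs ≤ m
      bound′ xs p with m≤n⇒m<n∨m≡n (bound xs p)
      ... | inj₁ (s≤s l) = l
      ... | inj₂ eq = contradiction
        (subst (λ k → ∃ λ (v : Vec (Fin n) k) → Path (toList v)) eq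
          (fromList xs , subst Path (sym (toList∘fromList xs)) p))
        ¬path

  -- Ancestor lists alone represent the tree. As an equation between lists, parenthood is decidable
  -- and the parent is unique.
  Parent : (Fin n → List (Fin n)) → Fin n → Fin n → Set
  Parent anc p v = anc v ≡ p ∷ anc p

  -- anc v lists the proper ancestors of v, nearest first.
  record NormalTree (root : Fin n) (anc : Fin n → List (Fin n)) : Set where
    field
      anc-root  : anc root ≡ []
      root-or-child : ∀ v → v ≡ root ⊎ ∃[ p ] (p ~ v × Parent anc p v)
      normal    : ∀ u v → u ~ v → u ∈ anc v ⊎ v ∈ anc u

  -- State of a depth-first search: new holds the unvisited vertices, on which
  -- anc has junk values; deep and path are carried along unchanged.
  record Search (root deep : Fin n) (path : List (Fin n))
                (anc : Fin n → List (Fin n)) (new stack : List (Fin n)) : Set where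
    field
      root∉new : root ∉ new
      deep∉new : deep ∉ new
      anc-root : anc root ≡ []
      anc-deep : anc deep ≡ path
      root-or-child : ∀ v → v ∉ new → v ≡ root ⊎ ∃[ p ] (p ∉ new × p ~ v × Parent anc p v)
      normal   : ∀ u v → u ∉ new → v ∉ new → u ~ v → u ∈ anc v ⊎ v ∈ anc u
      finished : ∀ v x → v ∉ new → x ∈ new → v ~ x → v ∈ stack
      stacked  : stack ≡ [] ⊎ ∃[ t ] (t ∉ new × stack ≡ t ∷ anc t)

  -- Normality survives because a visited neighbour of `u` still had an unvisited neighbour, hence
  -- lies on the stack, and the stack becomes the ancestor list of `u`.
  push : ∀ {r d l anc new t s u} → Search r d l anc new (t ∷ s) → u ∈ new → t ~ u →
    Search r d l (anc [ u ≔ t ∷ s ]) (new without u) (u ∷ t ∷ s)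
  push {r} {d} {l} {anc} {new} {t} {s} {u} S u∈ t~u = record
    { root∉new = root∉new ∘ proj₁ ∘ ∈-without new
    ; deep∉new = deep∉new ∘ proj₁ ∘ ∈-without new
    ; anc-root = trans (old root∉new) anc-root
    ; anc-deep = trans (old deep∉new) anc-deep
    ; root-or-child = root-or-child′
    ; normal = λ x y x∉ y∉ → normal′ x y (∉-without new x∉) (∉-without new y∉)
    ; finished = finished′
    ; stacked = inj₂ (u , u∉ , cong (u ∷_) (sym (≔-same anc u)))
    }
    where
    open Search S
    anc′ = anc [ u ≔ t ∷ s ]

    old : ∀ {x} → x ∉ new → anc′ x ≡ anc x
    old x∉ = ≔-other anc λ { refl → x∉ u∈ }

    u∉ : u ∉ new without u
    u∉ u∈′ = proj₂ (∈-without new u∈′) refl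

    still∉ : ∀ {x} → x ∉ new → x ∉ new without u
    still∉ x∉ = x∉ ∘ proj₁ ∘ ∈-without new

    top : t ∉ new × s ≡ anc t
    top with stacked
    ... | inj₂ (_ , t∉ , refl) = t∉ , refl

    root-or-child′ : ∀ v → v ∉ new without u → v ≡ r ⊎ ∃[ p ] (p ∉ new without u × p ~ v × Parent anc′ p v)
    root-or-child′ v v∉ with ∉-without new v∉
    ... | inj₁ refl = inj₂ (t , still∉ (proj₁ top) , t~u ,
      trans (≔-same anc u) (cong (t ∷_) (trans (proj₂ top) (sym (old (proj₁ top))))))
    ... | inj₂ v∉new with root-or-child v v∉new
    ...   | inj₁ v≡r = inj₁ v≡r
    ...   | inj₂ (p , p∉ , p~v , e) = inj₂ (p , still∉ p∉ , p~v ,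
      trans (old v∉new) (trans e (cong (p ∷_) (sym (old p∉)))))

    normal′ : ∀ x y → x ≡ u ⊎ x ∉ new → y ≡ u ⊎ y ∉ new → x ~ y → x ∈ anc′ y ⊎ y ∈ anc′ x
    normal′ x y (inj₁ refl) (inj₁ refl) e = contradiction e (~-irrefl x)
    normal′ x y (inj₁ refl) (inj₂ y∉) e =
      inj₂ (subst (y ∈_) (sym (≔-same anc u)) (finished y u y∉ u∈ (~-sym e)))
    normal′ x y (inj₂ x∉) (inj₁ refl) e = inj₁ (subst (x ∈_) (sym (≔-same anc u)) (finished x u x∉ u∈ e))
    normal′ x y (inj₂ x∉) (inj₂ y∉) e with normal x y x∉ y∉ e
    ... | inj₁ x∈ = inj₁ (subst (x ∈_) (sym (old y∉)) x∈)
    ... | inj₂ y∈ = inj₂ (subst (y ∈_) (sym (old x∉)) y∈)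

    finished′ : ∀ v x → v ∉ new without u → x ∈ new without u → v ~ x → v ∈ u ∷ t ∷ s
    finished′ v x v∉ x∈ e with ∉-without new v∉
    ... | inj₁ refl = here refl
    ... | inj₂ v∉new = there (finished v x v∉new (proj₁ (∈-without new x∈)) e)

  -- The rest of the stack is the ancestor list of `t`, so it is empty or headed by the parent of
  -- `t`.
  pop : ∀ {r d l anc new t s} → Search r d l anc new (t ∷ s) → (∀ u → u ∈ new → ¬ t ~ u) →
    Search r d l anc new s
  pop {r} {anc = anc} {new} {t} {s} S none = record
    { root∉new = root∉new ; deep∉new = deep∉new ; anc-root = anc-root ; anc-deep = anc-deep
    ; root-or-child = root-or-child ; normal = normal ; finished = finished′ ; stacked = stacked′ }
    where
    open Search S

    finished′ : ∀ v x → v ∉ new → x ∈ new → v ~ x → v ∈ s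
    finished′ v x v∉ x∈ e with finished v x v∉ x∈ e
    ... | here refl = contradiction e (none x x∈)
    ... | there v∈ = v∈

    stacked′ : s ≡ [] ⊎ ∃[ t ] (t ∉ new × s ≡ t ∷ anc t)
    stacked′ with stacked
    ... | inj₂ (_ , t∉ , refl) with root-or-child t t∉
    ...   | inj₁ refl = inj₁ anc-root
    ...   | inj₂ (p , p∉ , _ , e) = inj₂ (p , p∉ , e)

  module _ (connected : Connected G) where

    -- With an empty stack no edge leads from a visited to an unvisited vertex, so by connectedness
    -- everything is visited.
    stack-empty : ∀ {r d l anc new} → Search r d l anc new [] → NormalTree r anc
    stack-empty {r} {new = new} S = record
      { anc-root = anc-root ; root-or-child = rc ; normal = λ u v → normal u v (none u) (none v) }
      where
      open Search S

      reach : ∀ {u v} → Star _~_ u v → u ∉ new → v ∉ new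
      reach ε⋆ u∉ = u∉
      reach (_◅_ {j = w} e es) u∉ = reach es λ w∈ → case-[] (finished _ w u∉ w∈ e)
        where
        case-[] : ∀ {v : Fin n} → v ∉ []
        case-[] ()

      none : ∀ v → v ∉ new
      none v = reach (connected r v) root∉new

      rc : ∀ v → v ≡ r ⊎ ∃[ p ] (p ~ v × Parent _ p v)
      rc v with root-or-child v (none v)
      ... | inj₁ e = inj₁ e
      ... | inj₂ (p , _ , e) = inj₂ (p , e)

    -- Terminates lexicographically: a push uses up one of the at most `m` unvisited vertices, a pop
    -- shortens the stack.
    run : ∀ {r d l anc new} m stack → length new ≤ m → Search r d l anc new stack →
      ∃[ anc′ ] (NormalTree r anc′ × anc′ d ≡ l)
    run m [] _ S = _ , stack-empty S , Search.anc-deep S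
    run {new = new} m (t ∷ s) new≤m S with any? (λ u → ∈-dec _≟_ u new ×-dec (t ~? u))
    ... | no none = run m s new≤m (pop S λ u u∈ e → none (u , u∈ , e))
    ... | yes (u , u∈ , e) with m | ≤-trans (filter-notAll (λ x → ¬? (x ≟ u)) new (lose u∈ (λ u≢u → u≢u refl))) new≤m
    ...   | suc m′ | s≤s l = run m′ (u ∷ t ∷ s) l (push S u∈ e)

    -- The search begins by pushing the given path from its last vertex, which becomes the root; so
    -- `l` becomes the ancestor list of `d`.
    start : ∀ d l → Path (d ∷ l) → ∃[ r ] ∃[ anc ] ∃[ new ]
      (Search r d l anc new (d ∷ l) × (∀ x → x ∉ d ∷ l → x ∈ new))
    start d [] _ = d , (λ _ → []) , allFin n without d , record
      { root∉new = d∉ ; deep∉new = d∉ ; anc-root = refl ; anc-deep = refl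
      ; root-or-child = λ v v∉ → inj₁ (only v∉)
      ; normal = λ u v u∉ v∉ e → contradiction (subst (_~ v) (trans (only u∉) (sym (only v∉))) e) (~-irrefl v)
      ; finished = λ v x v∉ _ _ → here (only v∉)
      ; stacked = inj₂ (d , d∉ , refl) } ,
      λ x x∉ → ∈-filter⁺ (λ y → ¬? (y ≟ d)) (∈-allFin x) (x∉ ∘ here)
      where
      d∉ : d ∉ allFin n without d
      d∉ d∈ = proj₂ (∈-without (allFin n) d∈) refl
      only : ∀ {v} → v ∉ allFin n without d → v ≡ d
      only v∉ with ∉-without (allFin n) v∉
      ... | inj₁ e = e
      ... | inj₂ v∉all = contradiction (∈-allFin _) v∉all
    start d (c ∷ l) (c~d ∷ ls , u@(_ ∷ us)) with r , anc , new , S , rest ← start c l (ls , us) =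
      r , anc [ d ≔ c ∷ l ] , new without d ,
      -- From here on `d` replaces `c` as the vertex whose ancestor list is recorded.
      record { Search S′ ; deep∉new = λ d∈ → proj₂ (∈-without new d∈) refl ; anc-deep = ≔-same anc d } ,
      λ x x∉ → ∈-filter⁺ (λ y → ¬? (y ≟ d)) (rest x (x∉ ∘ there)) (x∉ ∘ here)
      where
      S′ = push S (rest d (Unique[x∷xs]⇒x∉xs u)) (~-sym c~d)

    normal-tree : ∀ d l → Path (d ∷ l) → ∃[ r ] ∃[ anc ] (NormalTree r anc × anc d ≡ l)
    normal-tree d l p with r , anc , new , S , _ ← start d l p = r , run (length new) (d ∷ l) ≤-refl S

-- Ancestry and depth in a normal tree

module Tree {n : ℕ} (G : Graph n) {root : Fin n} {anc : Fin n → List (Fin n)}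
            (T : NormalTree G root anc) where
  open Graph G
  open NormalTree T

  _isParentOf_ : Fin n → Fin n → Set
  p isParentOf v = Parent G anc p v

  isParentOf? : ∀ p v → Dec (p isParentOf v)
  isParentOf? p v = ≡-dec _≟_ (anc v) (p ∷ anc p)

  depth : Fin n → ℕ
  depth v = length (anc v)

  parent-depth : ∀ {p v} → p isParentOf v → depth v ≡ suc (depth p)
  parent-depth = cong length

  parent-depth< : ∀ {p v} → p isParentOf v → depth p < depth v
  parent-depth< e = ≤-reflexive (sym (parent-depth e))

  parent-unique : ∀ {p q v} → p isParentOf v → q isParentOf v → p ≡ q
  parent-unique e e′ = ∷-injectiveˡ (trans (sym e) e′)

  root-no-parent : ∀ {p} → ¬ p isParentOf root
  root-no-parent e with () ← trans (sym anc-root) e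

  parent⇒~ : ∀ {p v} → p isParentOf v → p ~ v
  parent⇒~ {v = v} e with root-or-child v
  ... | inj₁ refl = contradiction e root-no-parent
  ... | inj₂ (q , q~v , e′) = subst (_~ v) (parent-unique e′ e) q~v

  parent-of : ∀ {v} → v ≢ root → ∃[ p ] p isParentOf v
  parent-of {v} v≢r with root-or-child v
  ... | inj₁ v≡r = contradiction v≡r v≢r
  ... | inj₂ (p , _ , e) = p , e

  tree-induction : (P : Fin n → Set) → P root → (∀ {p v} → p isParentOf v → P p → P v) → ∀ v → P v
  tree-induction P P-root P-child v = go (anc v) v refl
    where
    go : ∀ l v → anc v ≡ l → P v
    go l v e with root-or-child v
    ... | inj₁ refl = P-root
    go [] v e | inj₂ (p , _ , e′) with () ← trans (sym e) e′
    go (_ ∷ l) v e | inj₂ (p , _ , e′) =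
      P-child e′ (go l p (sym (proj₂ (∷-injective (trans (sym e) e′)))))

  anc-depth : ∀ {a} v → a ∈ anc v → depth a < depth v
  anc-depth {a} = tree-induction (λ v → a ∈ anc v → depth a < depth v)
    (λ a∈ → contradiction (subst (a ∈_) anc-root a∈) λ ())
    λ {p} {v} e ih a∈ → step e ih (subst (a ∈_) e a∈)
    where
    step : ∀ {p v} → p isParentOf v → (a ∈ anc p → depth a < depth p) → a ∈ p ∷ anc p → depth a < depth v
    step e ih (here refl) = parent-depth< e
    step e ih (there a∈) = <-trans (ih a∈) (parent-depth< e)

  v∉anc : ∀ v → v ∉ anc v
  v∉anc v v∈ = <-irrefl refl (anc-depth v v∈)

  root-path : ∀ v → Path G (v ∷ anc v)
  root-path = tree-induction (λ v → Path G (v ∷ anc v))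
    (subst (λ l → Path G (root ∷ l)) (sym anc-root) ([-] , [] ∷ []))
    λ {p} {v} e (ls , u) → subst (λ l → Path G (v ∷ l)) (sym e)
      (~-sym (parent⇒~ e) ∷ ls , ∉⇒All≢ (v∉anc v ∘ subst (v ∈_) (sym e)) ∷ u)

  depth<n : ∀ v → depth v < n
  depth<n v = length-path≤ G (root-path v)

  -- Root paths have no repetitions, so depths stay below `n`, and `n` minus the depth bounds the
  -- recursion.
  leaf-induction : (P : Fin n → Set) → (∀ v → (∀ c → v isParentOf c → P c) → P v) → ∀ v → P v
  leaf-induction P P-step v = go n v (m≤m+n n (depth v))
    where
    go : ∀ m v → n ≤ m + depth v → P v
    go zero v n≤ = contradiction n≤ (<⇒≱ (depth<n v))
    go (suc m) v n≤ = P-step v λ c e → go m c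
      (subst (n ≤_) (trans (sym (+-suc m (depth v))) (cong (m +_) (sym (parent-depth e)))) n≤)

  Inner : Fin n → Set
  Inner v = ∃[ c ] v isParentOf c

  Inner? : ∀ v → Dec (Inner v)
  Inner? v = any? (isParentOf? v)

  ancestor⇒inner : ∀ {a} v → a ∈ anc v → Inner a
  ancestor⇒inner {a} = tree-induction (λ v → a ∈ anc v → Inner a)
    (λ a∈ → contradiction (subst (a ∈_) anc-root a∈) λ ())
    λ {p} {v} e ih a∈ → step e ih (subst (a ∈_) e a∈)
    where
    step : ∀ {p v} → p isParentOf v → (a ∈ anc p → Inner a) → a ∈ p ∷ anc p → Inner a
    step e ih (here refl) = _ , e
    step e ih (there a∈) = ih a∈

  -- Normality allows only ancestors and descendants as neighbours, and a leaf has no descendants.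
  leaf-neighbours : ∀ {u v} → ¬ Inner u → u ~ v → v ∈ anc u
  leaf-neighbours {u} {v} leaf e with normal u v e
  ... | inj₁ u∈ = contradiction (ancestor⇒inner v u∈) leaf
  ... | inj₂ v∈ = v∈

  -- Prolonging tree paths

  anc-snoc-root : ∀ v → ∃[ l ] v ∷ anc v ≡ l ∷ʳ root
  anc-snoc-root = tree-induction (λ v → ∃[ l ] v ∷ anc v ≡ l ∷ʳ root)
    ([] , cong (root ∷_) anc-root)
    λ {p} {v} e (l , eq) → v ∷ l , cong (v ∷_) (trans e eq)

  TreeEdge : Fin n → Fin n → Set
  TreeEdge u v = u isParentOf v ⊎ v isParentOf u

  TreePath : List (Fin n) → Set
  TreePath xs = Linked TreeEdge xs × Unique xs

  reverse-treePath : ∀ {xs} → TreePath xs → TreePath (reverse xs)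
  reverse-treePath (ls , u) = Linked-reverse swap ls , Unique-reverse u

  treePath⇒path : ∀ {xs} → TreePath xs → Path G xs
  treePath⇒path (ls , u) = Linked.map (λ { (inj₁ e) → parent⇒~ e ; (inj₂ e) → ~-sym (parent⇒~ e) }) ls , u

  module _ (e : Fin n) where

    Below : Fin n → Set
    Below v = e ∈ v ∷ anc v

    below-child : ∀ {p v} → p isParentOf v → Below p → Below v
    below-child e≡ = there ∘ subst (e ∈_) (sym e≡)

    below-parent : ∀ {p v} → p isParentOf v → v ≢ e → Below v → Below p
    below-parent e≡ v≢e (here refl) = contradiction refl v≢e
    below-parent e≡ v≢e (there e∈) = subst (e ∈_) e≡ e∈

    parent-not-below : ∀ {p} → p isParentOf e → ¬ Below p
    parent-not-below e≡ e∈ = v∉anc e (subst (e ∈_) (sym e≡) e∈)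

    -- A step along a tree edge crosses the boundary of the subtree of `e` only if it visits `e`;
    -- the same reason keeps an outside path outside.
    stays-below : ∀ {y ys} → Linked TreeEdge (y ∷ ys) → All (e ≢_) (y ∷ ys) → Below y → All Below (y ∷ ys)
    stays-below [-] _ b = b ∷ []
    stays-below (inj₁ yz ∷ ls) (_ ∷ e≢) b = b ∷ stays-below ls e≢ (below-child yz b)
    stays-below (inj₂ zy ∷ ls) (e≢y ∷ e≢) b = b ∷ stays-below ls e≢ (below-parent zy (e≢y ∘ sym) b)

    stays-not-below : ∀ {y ys} → Linked TreeEdge (y ∷ ys) → All (e ≢_) (y ∷ ys) → ¬ Below y →
      All (¬_ ∘ Below) (y ∷ ys)
    stays-not-below [-] _ b = b ∷ []
    stays-not-below (inj₁ yz ∷ ls) (_ ∷ e≢@(e≢z ∷ _)) b =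
      b ∷ stays-not-below ls e≢ (b ∘ below-parent yz (e≢z ∘ sym))
    stays-not-below (inj₂ zy ∷ ls) (_ ∷ e≢) b = b ∷ stays-not-below ls e≢ (b ∘ below-child zy)

  -- If the path goes down from `e`, it stays in the subtree of `e` and the parent of `e` is free.
  -- If it goes up, it stays outside and a child is free.
  extend : ∀ {e ys} → e ≢ root → Inner e → TreePath (e ∷ ys) → ∃[ x ] TreePath (x ∷ e ∷ ys)
  extend {e} {[]} _ (c , ec) (_ , u) = c , inj₂ ec ∷ [-] , (c≢e ∷ []) ∷ u
    where
    c≢e : c ≢ e
    c≢e refl = <-irrefl refl (parent-depth< ec)
  extend {e} {y ∷ ys} e≢r _ (inj₁ ey ∷ ls , u@(e≢ ∷ _)) with p , pe ← parent-of e≢r =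
    p , inj₁ pe ∷ inj₁ ey ∷ ls , ∉⇒All≢ p∉ ∷ u
    where
    p∉ : p ∉ e ∷ y ∷ ys
    p∉ (here refl) = <-irrefl refl (parent-depth< pe)
    p∉ (there p∈) = parent-not-below e pe
      (All.lookup (stays-below e ls e≢ (there (subst (e ∈_) (sym ey) (here refl)))) p∈)
  extend {e} {y ∷ ys} _ (c , ec) (inj₂ ye ∷ ls , u@(e≢ ∷ _)) =
    c , inj₂ ec ∷ inj₂ ye ∷ ls , ∉⇒All≢ c∉ ∷ u
    where
    c∉ : c ∉ e ∷ y ∷ ys
    c∉ (here refl) = <-irrefl refl (parent-depth< ec)
    c∉ (there c∈) = All.lookup (stays-not-below e ls e≢ (parent-not-below e ye)) c∈
      (there (subst (e ∈_) (sym ec) (here refl)))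

  -- The path is extended at its first vertex, reversed and extended again.
  extend-both : ∀ {e e′ xs l} → TreePath (e ∷ xs) → e ∷ xs ≡ l ∷ʳ e′ →
    e ≢ root → Inner e → e′ ≢ root → Inner e′ → ∃[ ys ] (Path G ys × length ys ≡ 2 + length (e ∷ xs))
  extend-both {e} {e′} {xs} {l} p snoc e≢r e-inner e′≢r e′-inner
    with x , p₁ ← extend e≢r e-inner p
    with y , p₂ ← extend e′≢r e′-inner (subst TreePath
           (trans (cong (λ ys → reverse (x ∷ ys)) snoc) (reverse-++ (x ∷ l) (e′ ∷ [])))
           (reverse-treePath p₁)) =
    _ , treePath⇒path p₂ ,
    cong suc (trans (length-reverse-snoc) (cong suc (cong length (sym snoc))))
    where
    length-reverse-snoc : length (e′ ∷ reverse (x ∷ l)) ≡ suc (length (l ∷ʳ e′))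
    length-reverse-snoc = trans (cong length (sym (reverse-++ (x ∷ l) (e′ ∷ [])))) (length-reverse (x ∷ l ∷ʳ e′))

  -- Children, neighbours and degrees

  children : Fin n → List (Fin n)
  children v = filter (isParentOf? v) (allFin n)

  children-unique : ∀ v → Unique (children v)
  children-unique v = Unique.filter⁺ (isParentOf? v) (Unique.allFin⁺ n)

  ∈-children⁺ : ∀ {v c} → v isParentOf c → c ∈ children v
  ∈-children⁺ {v} {c} = ∈-filter⁺ (isParentOf? v) (∈-allFin c)

  ∈-children⁻ : ∀ {v c} → c ∈ children v → v isParentOf c
  ∈-children⁻ {v} c∈ = proj₂ (∈-filter⁻ (isParentOf? v) {xs = allFin n} c∈)

  neighbours : Fin n → List (Fin n)
  neighbours v = filter (v ~?_) (allFin n)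

  children≤degree : ∀ v → length (children v) ≤ degree G v
  children≤degree v = Unique-⊆⇒length≤ (children-unique v) λ {c} c∈ →
    ∈-filter⁺ (v ~?_) (∈-allFin c) (parent⇒~ (∈-children⁻ c∈))

  -- The parent is one more neighbour. This strictness is what lets a cyclic interval of codes
  -- determine its start.
  children<degree : ∀ {v} → v ≢ root → length (children v) < degree G v
  children<degree {v} v≢r with p , pv ← parent-of v≢r =
    Unique-⊆⇒length≤ {ys = neighbours v} (∉⇒All≢ p∉ ∷ children-unique v) λ
      { (here refl) → ∈-filter⁺ (v ~?_) (∈-allFin p) (~-sym (parent⇒~ pv))
      ; {c} (there c∈) → ∈-filter⁺ (v ~?_) (∈-allFin c) (parent⇒~ (∈-children⁻ c∈)) }
    where
    p∉ : p ∉ children v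
    p∉ p∈ = <-irrefl refl (<-trans (parent-depth< pv) (parent-depth< (∈-children⁻ p∈)))

  upNeighbours : Fin n → List (Fin n)
  upNeighbours v = filter (v ~?_) (anc v)

  upNeighbours-unique : ∀ v → Unique (upNeighbours v)
  upNeighbours-unique v with proj₂ (root-path v)
  ... | _ ∷ u = Unique.filter⁺ (v ~?_) u

  leaf-degree : ∀ {v} → ¬ Inner v → degree G v ≤ length (upNeighbours v)
  leaf-degree {v} leaf = Unique-⊆⇒length≤ (Unique.filter⁺ (v ~?_) (Unique.allFin⁺ n)) λ x∈ →
    let v~x = proj₂ (∈-filter⁻ (v ~?_) {xs = allFin n} x∈) in
    ∈-filter⁺ (v ~?_) (leaf-neighbours leaf v~x) v~x

-- Codes and colours

module _ (N : ℕ) .{{_ : NonZero N}} where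

  -- If `t` is the quotient of `q + s` by `N`, then cancelling `q` leaves `s ≡ t * N`, and `s < N`
  -- forces `t` to be zero.
  +-%-fixed : ∀ {q s} → s < N → (q + s) % N ≡ q → s ≡ 0
  +-%-fixed {q} {s} s<N eq with (q + s) / N | m≡m%n+[m/n]*n (q + s) N
  ... | t | e with t | +-cancelˡ-≡ q s (t * N) (trans e (cong (_+ t * N) eq))
  ...   | zero  | s≡0 = s≡0
  ...   | suc t | s≡  = contradiction (subst (_< N) s≡ s<N) (<⇒≱ (s≤s (m≤m+n N (t * N))))

  %-+ : ∀ q s → (q % N + s) % N ≡ (q + s) % N
  %-+ q s = trans (%-distribˡ-+ (q % N) s N)
    (trans (cong (λ x → (x + s % N) % N) (m%n%n≡m%n q N)) (sym (%-distribˡ-+ q s N)))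

  +-%-injective-≤ : ∀ q {i j} → i ≤ j → j < N → (q + i) % N ≡ (q + j) % N → i ≡ j
  +-%-injective-≤ q {i} {j} i≤j j<N eq = ≤-antisym i≤j (m∸n≡0⇒m≤n
    (+-%-fixed (≤-<-trans (m∸n≤m j i) j<N) (begin
      ((q + i) % N + (j ∸ i)) % N  ≡⟨ %-+ (q + i) (j ∸ i) ⟩
      (q + i + (j ∸ i)) % N        ≡⟨ cong (_% N) (+-assoc q i (j ∸ i)) ⟩
      (q + (i + (j ∸ i))) % N      ≡⟨ cong (λ x → (q + x) % N) (m+[n∸m]≡n i≤j) ⟩
      (q + j) % N                  ≡⟨ eq ⟨
      (q + i) % N                  ∎)))
    where open ≡-Reasoning

  +-%-injective : ∀ q {i j} → i < N → j < N → (q + i) % N ≡ (q + j) % N → i ≡ j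
  +-%-injective q {i} {j} i<N j<N eq with ≤-total i j
  ... | inj₁ i≤j = +-%-injective-≤ q i≤j j<N eq
  ... | inj₂ j≤i = sym (+-%-injective-≤ q j≤i i<N (sym eq))

digitAt<base : ∀ {n} b .{{_ : NonZero b}} q (xs : List (Fin n)) t → digitAt b q xs t < b
digitAt<base b q [] t = >-nonZero⁻¹ b
digitAt<base b q (x ∷ xs) t with x ≟ t
... | yes _ = m%n<n q b
... | no _  = digitAt<base b (q / b) xs t

module Colouring {n : ℕ} (G : Graph n) {root : Fin n} {anc : Fin n → List (Fin n)}
                 (T : NormalTree G root anc) (b : ℕ) .{{b≢0 : NonZero b}} where
  open Graph G
  open NormalTree T
  open Tree G T

  module _ (code : Fin n → ℕ) where

    -- Here `a` is meant to be an ancestor of `v`. The shift of the digits by one reserves 0 for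
    -- tree edges between inner vertices, which makes these recognisable.
    downColour : Fin n → Fin n → ℕ
    downColour a v with Inner? v
    ... | no _ = suc (digitAt b (code v) (upNeighbours v) a)
    ... | yes _ with isParentOf? a v
    ...   | yes _ = 0
    ...   | no _  = 1

    -- Adjacent vertices of a normal tree have different depths, so comparing depths finds the upper
    -- end.
    colour : Fin n → Fin n → ℕ
    colour u v with depth u <? depth v
    ... | yes _ = downColour u v
    ... | no  _ = downColour v u

    downColour≤base : ∀ a v → downColour a v < suc b
    downColour≤base a v with Inner? v
    ... | no _ = s≤s (digitAt<base b (code v) (upNeighbours v) a)
    ... | yes _ with isParentOf? a v
    ...   | yes _ = s≤s z≤n
    ...   | no _  = s≤s (>-nonZero⁻¹ b)

    colour≤base : ∀ u v → colour u v < suc b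
    colour≤base u v with depth u <? depth v
    ... | yes _ = downColour≤base u v
    ... | no  _ = downColour≤base v u

    colour-down : ∀ {a v} → depth a < depth v → colour a v ≡ downColour a v
    colour-down {a} {v} a<v with depth a <? depth v
    ... | yes _ = refl
    ... | no a≮v = contradiction a<v a≮v

    colour-up : ∀ {a v} → depth a < depth v → colour v a ≡ downColour a v
    colour-up {a} {v} a<v with depth v <? depth a
    ... | yes v<a = contradiction a<v (<-asym v<a)
    ... | no _ = refl

    data Oriented (u v : Fin n) : Set where
      down : depth u < depth v → colour u v ≡ downColour u v → Oriented u v
      up   : depth v < depth u → colour u v ≡ downColour v u → Oriented u v

    orient : ∀ {u v} → u ~ v → Oriented u v
    orient {u} {v} e with normal u v e
    ... | inj₁ u∈ = down (anc-depth v u∈) (colour-down (anc-depth v u∈))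
    ... | inj₂ v∈ = up (anc-depth u v∈) (colour-up (anc-depth u v∈))

    colour-sym : EdgeSymmetric G colour
    colour-sym u v e with orient e
    ... | down u<v eq = trans eq (sym (colour-up u<v))
    ... | up v<u eq = trans eq (sym (colour-down v<u))

    parent-colour : ∀ {p v} → p isParentOf v → Inner v → colour p v ≡ 0
    parent-colour {p} {v} e v-inner = trans (colour-down (parent-depth< e)) down≡0
      where
      down≡0 : downColour p v ≡ 0
      down≡0 with Inner? v
      ... | no ¬inner = contradiction v-inner ¬inner
      ... | yes _ with isParentOf? p v
      ...   | yes _ = refl
      ...   | no ¬e = contradiction e ¬e

    leaf-colour : ∀ {a v} → ¬ Inner v → a ∈ anc v →
      colour a v ≡ suc (digitAt b (code v) (upNeighbours v) a)
    leaf-colour {a} {v} leaf a∈ = trans (colour-down (anc-depth v a∈)) down≡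
      where
      down≡ : downColour a v ≡ suc (digitAt b (code v) (upNeighbours v) a)
      down≡ with Inner? v
      ... | no _ = refl
      ... | yes inner = contradiction inner leaf

    downColour-0 : ∀ {a v} → downColour a v ≡ 0 → a isParentOf v × Inner v
    downColour-0 {a} {v} eq with Inner? v
    ... | yes v-inner with isParentOf? a v
    ...   | yes e = e , v-inner

    colour-0 : ∀ {u v} → u ~ v → colour u v ≡ 0 → (u isParentOf v × Inner v) ⊎ (v isParentOf u × Inner u)
    colour-0 e eq with orient e
    ... | down _ d = inj₁ (downColour-0 (trans (sym d) eq))
    ... | up _ d   = inj₂ (downColour-0 (trans (sym d) eq))

    module _ {f g : Fin n → Fin n} (φ : ColourAut G colour f g) where
      open ColourAut φ

      f-injective : ∀ {x y} → f x ≡ f y → x ≡ y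
      f-injective {x} {y} eq = trans (sym (gf x)) (trans (cong g eq) (gf y))

      -- Both orientations are possible as long as `f` may move the root.
      image-0 : ∀ {p v} → p isParentOf v → Inner v →
        (f p isParentOf f v × Inner (f v)) ⊎ (f v isParentOf f p × Inner (f p))
      image-0 {p} {v} e v-inner = colour-0 (f-edge p v (parent⇒~ e))
        (trans (f-col p v (parent⇒~ e)) (parent-colour e v-inner))

      image-inner-child : ∀ {p v} → p isParentOf v → Inner v → Inner (f v)
      image-inner-child e v-inner with image-0 e v-inner
      ... | inj₁ (_ , i) = i
      ... | inj₂ (e′ , _) = _ , e′

      image-inner-parent : ∀ {p v} → p isParentOf v → Inner v → Inner (f p)
      image-inner-parent e v-inner with image-0 e v-inner
      ... | inj₁ (e′ , _) = _ , e′
      ... | inj₂ (_ , i) = i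

    -- Automorphisms that fix the root

    root-fixed-inverse : ∀ {f g} → ColourAut G colour f g → f root ≡ root → g root ≡ root
    root-fixed-inverse {f} {g} φ fr = trans (cong g (sym fr)) (ColourAut.gf φ root)

    image-inner : ∀ {f g} → ColourAut G colour f g → f root ≡ root → ∀ {v} → Inner v → Inner (f v)
    image-inner φ fr {v} v-inner with root-or-child v
    ... | inj₁ refl = subst Inner (sym fr) v-inner
    ... | inj₂ (p , _ , e) = image-inner-child φ e v-inner

    image-leaf : ∀ {f g} → ColourAut G colour f g → f root ≡ root → ∀ {v} → ¬ Inner v → ¬ Inner (f v)
    image-leaf φ fr {v} leaf i = leaf (subst Inner (ColourAut.gf φ v)
      (image-inner (ColourAut-inverse G φ) (root-fixed-inverse φ fr) i))

    -- By induction from the root: an edge turned upside down would make `f v` the parent of `f p`.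
    -- The root has no parent, and otherwise that parent is already the image of the parent of `p`.
    image-parent-inner : ∀ {f g} → ColourAut G colour f g → f root ≡ root →
      ∀ v → Inner v → ∀ {p} → p isParentOf v → f p isParentOf f v
    image-parent-inner {f} {g} φ fr = tree-induction _
      (λ _ e → contradiction e root-no-parent)
      λ {p} {v} e ih v-inner {p′} e′ →
        subst (λ q → f q isParentOf f v) (parent-unique e e′) (step e ih v-inner)
      where
      step : ∀ {p v} → p isParentOf v → (Inner p → ∀ {q} → q isParentOf p → f q isParentOf f p) → Inner v →
        f p isParentOf f v
      step {p} {v} e ih v-inner with image-0 φ e v-inner
      ... | inj₁ (e′ , _) = e′
      ... | inj₂ (e′ , _) with root-or-child p
      ...   | inj₁ refl = contradiction (subst (f v isParentOf_) fr e′) root-no-parent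
      ...   | inj₂ (q , _ , qp) = contradiction (<-trans (parent-depth< qp) (parent-depth< e))
        (<-irrefl (cong depth (f-injective φ (parent-unique (ih (_ , e) qp) e′))))

    image-depth-inner : ∀ {f g} → ColourAut G colour f g → f root ≡ root → ∀ v → Inner v → depth (f v) ≡ depth v
    image-depth-inner φ fr = tree-induction _ (λ _ → cong depth fr)
      λ {p} {v} e ih v-inner → trans (parent-depth (image-parent-inner φ fr v v-inner e))
        (trans (cong suc (ih (_ , e))) (sym (parent-depth e)))

    -- The parent of a leaf is its deepest neighbour, and `f` preserves the depths of inner
    -- vertices: if `f p` were above the parent `q` of `f v`, then `g q` would be a neighbour of `v`
    -- deeper than `p`.
    image-parent : ∀ {f g} → ColourAut G colour f g → f root ≡ root → ∀ {p v} → p isParentOf v → f p isParentOf f v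
    image-parent {f} {g} φ fr {p} {v} e with Inner? v
    ... | yes v-inner = image-parent-inner φ fr v v-inner e
    ... | no leaf = goal
      where
      open ColourAut φ
      fv≢r : f v ≢ root
      fv≢r eq with refl ← f-injective φ (trans eq (sym fr)) = root-no-parent e

      goal : f p isParentOf f v
      goal with q , qfv ← parent-of fv≢r
           with subst (f p ∈_) qfv (leaf-neighbours (image-leaf φ fr leaf) (~-sym (f-edge p v (parent⇒~ e))))
      ... | here fp≡q = subst (_isParentOf f v) (sym fp≡q) qfv
      ... | there fp∈ = contradiction gq≤p (<⇒≱ p<gq)
        where
        gq-depth : depth (g q) ≡ depth q
        gq-depth = image-depth-inner (ColourAut-inverse G φ) (root-fixed-inverse φ fr) q (_ , qfv)

        p<gq : depth p < depth (g q)
        p<gq = subst₂ _<_ (image-depth-inner φ fr p (_ , e)) (sym gq-depth) (anc-depth q fp∈)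

        gq≤p : depth (g q) ≤ depth p
        gq≤p = s≤s⁻¹ (subst (depth (g q) <_) (parent-depth e)
          (anc-depth v (leaf-neighbours leaf (~-sym (subst (g q ~_) (gf v) (g-edge q (f v) (parent⇒~ qfv)))))))

    image-anc : ∀ {f g} → ColourAut G colour f g → f root ≡ root → ∀ v → anc (f v) ≡ map f (anc v)
    image-anc {f} φ fr = tree-induction _
      (trans (cong anc fr) (trans anc-root (cong (map f) (sym anc-root))))
      λ {p} {v} e ih → trans (image-parent φ fr e) (trans (cong (f p ∷_) ih) (cong (map f) (sym e)))

    filter-image : ∀ {f g} → ColourAut G colour f g → ∀ v xs → filter (f v ~?_) (map f xs) ≡ map f (filter (v ~?_) xs)
    filter-image φ v [] = refl
    filter-image {f} {g} φ v (x ∷ xs) with v ~? x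
    ... | yes e = trans (filter-accept (f v ~?_) (ColourAut.f-edge φ v x e)) (cong (f x ∷_) (filter-image φ v xs))
    ... | no ¬e = trans (filter-reject (f v ~?_) λ e → ¬e (subst₂ _~_ (gf v) (gf x) (g-edge _ _ e))) (filter-image φ v xs)
      where open ColourAut φ

    -- The upper neighbours of `f v` are the images of those of `v` in the same order, so equal
    -- colours spell equal digits.
    leaf-code : ∀ {f g} → ColourAut G colour f g → f root ≡ root → ∀ {d v} → ¬ Inner v → d ≤ degree G v →
      code v < b ^ d → code (f v) < b ^ d → code (f v) ≡ code v
    leaf-code {f} {g} φ fr {d} {v} leaf d≤ v< fv< = sym
      (digits-determine b (upNeighbours-unique v) (≤-trans d≤ (leaf-degree leaf)) v< fv< λ {t} t∈ →
        let t∈anc , v~t = ∈-filter⁻ (v ~?_) {xs = anc v} t∈ in suc-injective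
        (trans (sym (leaf-colour leaf t∈anc)) (trans (sym (f-col t v (~-sym v~t))) (trans
          (leaf-colour (image-leaf φ fr leaf) (leaf-neighbours (image-leaf φ fr leaf) (f-edge v t v~t)))
          (cong suc (trans (cong (λ l → digitAt b (code (f v)) l (f t)) upNeighbours-image)
            (digitAt-map b (f-injective φ) (code (f v)) (upNeighbours v) t)))))))
      where
      open ColourAut φ
      upNeighbours-image : upNeighbours (f v) ≡ map f (upNeighbours v)
      upNeighbours-image = trans (cong (filter (f v ~?_)) (image-anc φ fr v)) (filter-image φ v (anc v))

-- Recovering codes and a criterion for rigidity

module Rigidity {n : ℕ} (G : Graph n) {root : Fin n} {anc : Fin n → List (Fin n)}
                (T : NormalTree G root anc) (b : ℕ) .{{b≢0 : NonZero b}}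
                (d : ℕ) .{{N≢0 : NonZero (b ^ d)}}
                (d≤degree : ∀ v → d ≤ degree G v) (degree≤N : ∀ v → degree G v ≤ b ^ d) where
  open Graph G
  open NormalTree T
  open Tree G T
  open Colouring G T b

  N : ℕ
  N = b ^ d

  -- Stated vertex by vertex, because the children of one vertex may be coded differently.
  Standard : (Fin n → ℕ) → Fin n → Set
  Standard code v = ∀ {c} → v isParentOf c → code c ≡ (code v + position (children v) c) % N

  SiblingsDiffer : (Fin n → ℕ) → Set
  SiblingsDiffer code = ∀ {p u v} → p isParentOf u → p isParentOf v → code u ≡ code v → u ≡ v

  standard-siblings : ∀ code {p u v} → Standard code p → p isParentOf u → p isParentOf v → code u ≡ code v → u ≡ v
  standard-siblings code {p} std pu pv eq = position-injective (∈-children⁺ pu) (∈-children⁺ pv)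
    (+-%-injective N (code p) (bound pu) (bound pv) (trans (sym (std pu)) (trans eq (std pv))))
    where
    bound : ∀ {c} → p isParentOf c → position (children p) c < N
    bound pc = ≤-trans (position<length (∈-children⁺ pc)) (≤-trans (children≤degree p) (degree≤N p))

  module _ (code : Fin n → ℕ) (code< : ∀ v → code v < N) where

    -- The codes of the m children of v form the cyclic interval of length m
    -- that starts at code v; as 0 < m < N, its start can be recovered.
    image-code : ∀ {f g} → ColourAut G (colour code) f g → f root ≡ root →
      (∀ v → v ≢ root → f v ≡ v ⊎ (Standard code v × Standard code (f v))) →
      ∀ v → code (f v) ≡ code v
    image-code {f} {g} φ fr fixed-or-standard = leaf-induction _ step
      where
      open ColourAut φ

      step : ∀ v → (∀ c → v isParentOf c → code (f c) ≡ code c) → code (f v) ≡ code v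
      step v ih with Inner? v
      ... | no leaf = leaf-code code φ fr leaf (d≤degree v) (code< v) (code< (f v))
      ... | yes (c , vc) with v ≟ root
      ...   | yes refl = cong code fr
      ...   | no v≢r with fixed-or-standard v v≢r
      ...     | inj₁ fv≡v = cong code fv≡v
      -- The first child `c₀` of `v` has the same code as `v`.
      ...     | inj₂ (std , std′)
        with c₀ , c₀∈ , c₀-first ← position-surjective (children-unique v)
               (≤-trans (s≤s z≤n) (position<length (∈-children⁺ vc)))
        = sym (from-position (position (children (f v)) (f c₀)) refl)
        where
        vc₀ : v isParentOf c₀
        vc₀ = ∈-children⁻ c₀∈

        fvc₀ : f v isParentOf f c₀
        fvc₀ = image-parent code φ fr vc₀

        code-v : code v ≡ (code (f v) + position (children (f v)) (f c₀)) % N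
        code-v = trans (sym (m<n⇒m%n≡m (code< v)))
          (trans (cong (_% N) (sym (trans (cong (code v +_) c₀-first) (+-identityʳ (code v)))))
          (trans (sym (std vc₀)) (trans (sym (ih c₀ vc₀)) (std′ fvc₀))))

        from-position : ∀ i → position (children (f v)) (f c₀) ≡ i → code v ≡ code (f v)
        from-position zero eq = trans code-v (trans (cong (λ i → (code (f v) + i) % N) eq)
          (trans (cong (_% N) (+-identityʳ (code (f v)))) (m<n⇒m%n≡m (code< (f v)))))
        -- If `f c₀` is not first, let `c₁` be the child of `f v` just before it. Then `g c₁` is a
        -- child of `v`, at position `l`, whose code precedes that of `c₀`; so `code v` is fixed by
        -- the shift by `suc l`.
        from-position (suc i) eq
          with c₁ , c₁∈ , c₁-pos ← position-surjective (children-unique (f v))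
                 (<-trans (n<1+n i) (subst (_< length (children (f v))) eq (position<length (∈-children⁺ fvc₀))))
          = contradiction (+-%-fixed N l< (sym code-v≡)) λ ()
          where
          v-gc₁ : v isParentOf g c₁
          v-gc₁ = subst (_isParentOf g c₁) (gf v)
            (image-parent code (ColourAut-inverse G φ) (root-fixed-inverse code φ fr) (∈-children⁻ c₁∈))

          l = position (children v) (g c₁)

          l< : suc l < N
          l< = ≤-<-trans (position<length (∈-children⁺ v-gc₁)) (≤-trans (children<degree v≢r) (degree≤N v))

          codes≡ : (code (f v) + i) % N ≡ (code v + l) % N
          codes≡ = trans (cong (λ j → (code (f v) + j) % N) (sym c₁-pos)) (trans (sym (std′ (∈-children⁻ c₁∈)))
            (trans (cong code (sym (fg c₁))) (trans (ih (g c₁) v-gc₁) (std v-gc₁))))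

          shift : ∀ q i → (q + suc i) % N ≡ ((q + i) % N + 1) % N
          shift q i = trans (cong (_% N) (trans (cong (q +_) (+-comm 1 i)) (sym (+-assoc q i 1)))) (sym (%-+ N (q + i) 1))

          code-v≡ : code v ≡ (code v + suc l) % N
          code-v≡ = trans code-v (trans (cong (λ j → (code (f v) + j) % N) eq) (trans (shift (code (f v)) i)
            (trans (cong (λ x → (x + 1) % N) codes≡) (sym (shift (code v) l)))))

    -- From the root downwards: once the parent of `v` is fixed, `f v` is a sibling of `v` with the
    -- same code.
    rigid : SiblingsDiffer code →
      (∀ {f g} → ColourAut G (colour code) f g → f root ≡ root) →
      (∀ {f g} → ColourAut G (colour code) f g → f root ≡ root →
        ∀ v → v ≢ root → f v ≡ v ⊎ (Standard code v × Standard code (f v))) →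
      Rigid G (colour code)
    rigid differ fix std f g φ = tree-induction _ fr λ {p} {v} e fp≡p →
      differ (subst (_isParentOf f v) fp≡p (image-parent code φ fr e)) e (image-code φ fr (std φ fr) v)
      where
      fr : f root ≡ root
      fr = fix φ

  -- The ancestor list is a separate argument to make the recursion structural. The root gets code
  -- 0.
  codeAlong : Fin n → List (Fin n) → ℕ
  codeAlong v [] = 0
  codeAlong v (p ∷ as) = (codeAlong p as + position (children p) v) % N

  standardCode : Fin n → ℕ
  standardCode v = codeAlong v (anc v)

  standardCode-standard : ∀ v → Standard standardCode v
  standardCode-standard v {c} e = cong (codeAlong c) e

  standardCode< : ∀ v → standardCode v < N
  standardCode< v with anc v
  ... | [] = >-nonZero⁻¹ N
  ... | p ∷ as = m%n<n _ N

  -- Edges of colour 1 and automorphisms that move the root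

  ones : (Fin n → ℕ) → Fin n → List (Fin n)
  ones code v = filter (λ x → (v ~? x) ×-dec (colour code v x ℕ.≟ 1)) (allFin n)

  module _ (code : Fin n → ℕ) {f g : Fin n → Fin n} (φ : ColourAut G (colour code) f g) where

    image-of-root-path : ∀ v → Inner v → Linked TreeEdge (f v ∷ map f (anc v))
    image-of-root-path = tree-induction _
      (λ _ → subst (λ l → Linked TreeEdge (f root ∷ map f l)) (sym anc-root) [-])
      λ {p} {v} e ih v-inner → subst (λ l → Linked TreeEdge (f v ∷ map f l)) (sym e) (edge e v-inner ∷ ih (_ , e))
      where
      edge : ∀ {p v} → p isParentOf v → Inner v → TreeEdge (f v) (f p)
      edge e v-inner with image-0 code φ e v-inner
      ... | inj₁ (e′ , _) = inj₂ e′
      ... | inj₂ (e′ , _) = inj₁ e′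

    -- The root path of `v` starts with a 0-edge at the root, and both ends of its image are inner.
    image-root-inner : ∀ v → Inner v → v ≢ root → Inner (f root)
    image-root-inner = tree-induction _ (λ _ r≢r → contradiction refl r≢r) step
      where
      step : ∀ {p v} → p isParentOf v → (Inner p → p ≢ root → Inner (f root)) → Inner v → v ≢ root → Inner (f root)
      step {p} e ih v-inner _ with p ≟ root
      ... | yes refl = image-inner-parent code φ e v-inner
      ... | no p≢r = ih (_ , e) p≢r

    -- Otherwise the image of the root path of z is a tree path both of whose
    -- ends are inner vertices other than the root, and so can be prolonged at
    -- both ends.
    moved-root : ∀ {z} → z ≢ root → Inner z → (∀ xs → Path G xs → length xs ≤ 2 + depth z) →
      f root ≢ root → f z ≡ root
    moved-root {z} z≢r z-inner longest fr≢r = decidable-stable (f z ≟ root) λ fz≢r →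
      let l , snoc = anc-snoc-root z
          p , pz = parent-of z≢r
          ys , ys-path , ys-length = extend-both
            (image-of-root-path z z-inner , Unique.map⁺ (f-injective code φ) (proj₂ (root-path z)))
            (trans (cong (map f) snoc) (map-++ f l (root ∷ [])))
            fz≢r (image-inner-child code φ pz z-inner) fr≢r (image-root-inner z z-inner z≢r)
      -- The root path of `z` has `1 + depth z` vertices; with two more it exceeds the bound
      -- `2 + depth z`.
      in <⇒≱ (≤-reflexive (sym (trans ys-length (cong (3 +_) (length-map f (anc z)))))) (longest ys ys-path)

    ones-image : ∀ v → length (ones code v) ≤ length (ones code (f v))
    ones-image v = subst (_≤ length (ones code (f v))) (length-map f (ones code v))
      (Unique-⊆⇒length≤ (Unique.map⁺ (f-injective code φ) (Unique.filter⁺ one? (Unique.allFin⁺ n)))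
        λ fx∈ → let x , x∈ , eq = ∈-map⁻ f fx∈
                    v~x , one = proj₂ (∈-filter⁻ one? {xs = allFin n} x∈)
                in subst (_∈ ones code (f v)) (sym eq)
                     (∈-filter⁺ _ (∈-allFin (f x)) (f-edge v x v~x , trans (f-col v x v~x) one)))
      where
      open ColourAut φ
      one? = λ x → (v ~? x) ×-dec (colour code v x ℕ.≟ 1)

-- The case of a movable root

-- The codes of the children of one vertex, prescribed so that changing ε from
-- 0 to 1 affects a single one of them.
specialCode : ℕ → ℕ → ℕ
specialCode ε zero = ε
specialCode ε (suc i) = suc (suc i)

specialCode-injective : ∀ {ε i j} → ε ≤ 1 → specialCode ε i ≡ specialCode ε j → i ≡ j
specialCode-injective {i = zero} {zero} _ _ = refl
specialCode-injective {i = zero} {suc j} (s≤s ()) refl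
specialCode-injective {i = suc i} {zero} (s≤s ()) refl
specialCode-injective {i = suc i} {suc j} _ eq = suc-injective eq

module Existence {n : ℕ} (G : Graph n) {root : Fin n} {anc : Fin n → List (Fin n)}
                 (T : NormalTree G root anc) (b : ℕ) .{{b≢0 : NonZero b}}
                 (d : ℕ) .{{N≢0 : NonZero (b ^ d)}}
                 (d≤degree : ∀ v → d ≤ degree G v) (degree≤N : ∀ v → degree G v ≤ b ^ d)
                 (1<b : 1 < b) (1<d : 1 < d) (bottom : Fin n)
                 (longest : ∀ xs → Path G xs → length xs ≤ suc (length (anc bottom))) where
  open Graph G
  open NormalTree T
  open Tree G T
  open Colouring G T b
  open Rigidity G T b d d≤degree degree≤N

  depth≤bottom : ∀ v → depth v ≤ depth bottom
  depth≤bottom v = s≤s⁻¹ (longest (v ∷ anc v) (root-path v))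

  bottom-leaf : ¬ Inner bottom
  bottom-leaf (c , e) = <⇒≱ (parent-depth< e) (depth≤bottom c)

  root-inner : Inner root
  root-inner with neighbours root in eq | d≤degree root
  ... | [] | d≤0 = contradiction (≤-trans 1<d d≤0) λ ()
  ... | x ∷ _ | _ with normal root x (proj₂ (∈-filter⁻ (root ~?_) {xs = allFin n} (subst (x ∈_) (sym eq) (here refl))))
  ...   | inj₁ r∈ = ancestor⇒inner x r∈
  ...   | inj₂ x∈ = contradiction (subst (x ∈_) anc-root x∈) λ ()

  z-bottom : ∃[ z ] z isParentOf bottom
  z-bottom = parent-of λ { refl → bottom-leaf root-inner }

  -- An inner vertex of maximal depth, as its child `bottom` is a deepest vertex of the tree.
  z : Fin n
  z = proj₁ z-bottom

  z-inner : Inner z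
  z-inner = bottom , proj₂ z-bottom

  depth-bottom : depth bottom ≡ suc (depth z)
  depth-bottom = parent-depth (proj₂ z-bottom)

  -- The leaf `bottom` has at least two neighbours, all of them ancestors, so its depth is at least
  -- 2.
  z≢root : z ≢ root
  z≢root z≡r = <⇒≱ (≤-trans 1<d (≤-trans (d≤degree bottom) (leaf-degree bottom-leaf)))
    (≤-trans (length-filter (bottom ~?_) (anc bottom)) (≤-reflexive (trans depth-bottom (cong suc depth-z≡0))))
    where
    depth-z≡0 : depth z ≡ 0
    depth-z≡0 = trans (cong depth z≡r) (cong length anc-root)

  longest-z : ∀ xs → Path G xs → length xs ≤ 2 + depth z
  longest-z xs p = subst (λ m → length xs ≤ suc m) depth-bottom (longest xs p)

  z-grandchildless : ∀ {v} → z isParentOf v → ¬ Inner v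
  z-grandchildless {v} zv (c , vc) = <⇒≱
    (subst (_< depth c) (trans (parent-depth zv) (sym depth-bottom)) (parent-depth< vc))
    (depth≤bottom c)

  Rival : Fin n → Set
  Rival y = y ≢ z × Inner y × depth y ≡ depth z

  -- If the root moved, both `y` and `z` would be sent to it.
  rival⇒root-fixed : ∀ {y} → Rival y → ∀ code {f g} → ColourAut G (colour code) f g → f root ≡ root
  rival⇒root-fixed {y} (y≢z , y-inner , y-depth) code {f} φ = decidable-stable (f root ≟ root) λ fr≢r →
    y≢z (f-injective code φ (trans
      (moved-root code φ y≢root y-inner
        (subst (λ m → ∀ xs → Path G xs → length xs ≤ 2 + m) (sym y-depth) longest-z) fr≢r)
      (sym (moved-root code φ z≢root z-inner longest-z fr≢r))))
    where
    y≢root : y ≢ root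
    y≢root refl with p , pz ← parent-of z≢root
      with () ← trans (sym (parent-depth pz)) (trans (sym y-depth) (cong length anc-root))

  -- If the root moves under `f`, it moves under `g` too, and both send `z` to it. So `f` swaps the
  -- two, and they have equally many 1-edges.
  unbalanced⇒root-fixed : ∀ code → length (ones code root) ≢ length (ones code z) →
    ∀ {f g} → ColourAut G (colour code) f g → f root ≡ root
  unbalanced⇒root-fixed code ≢ones {f} {g} φ = decidable-stable (f root ≟ root) λ fr≢r →
    let z-moves : ∀ {f g} → ColourAut G (colour code) f g → f root ≢ root → f z ≡ root
        z-moves φ = moved-root code φ z≢root z-inner longest-z
        fz≡r = z-moves φ fr≢r
        gz≡r = z-moves (ColourAut-inverse G φ) λ gr≡r → fr≢r (trans (cong f (sym gr≡r)) (ColourAut.fg φ root))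
        fr≡z = trans (cong f (sym gz≡r)) (ColourAut.fg φ z)
    in ≢ones (≤-antisym
      (subst (λ x → length (ones code root) ≤ length (ones code x)) fr≡z (ones-image code φ root))
      (subst (λ x → length (ones code z) ≤ length (ones code x)) fz≡r (ones-image code φ z)))

  code : ℕ → Fin n → ℕ
  code ε v with isParentOf? z v
  ... | yes _ = specialCode ε (position (children z) v)
  ... | no  _ = standardCode v

  code-child : ∀ ε {v} → z isParentOf v → code ε v ≡ specialCode ε (position (children z) v)
  code-child ε {v} zv with isParentOf? z v
  ... | yes _ = refl
  ... | no ¬zv = contradiction zv ¬zv

  code-other : ∀ ε {v} → ¬ z isParentOf v → code ε v ≡ standardCode v
  code-other ε {v} ¬zv with isParentOf? z v
  ... | yes zv = contradiction zv ¬zv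
  ... | no _ = refl

  -- The recoded vertices are the children of `z`. They are leaves, so neither `v`, if it has a
  -- child, nor that child is among them.
  code-standard : ∀ ε {v} → v ≢ z → Standard (code ε) v
  code-standard ε {v} v≢z {c} vc = trans (code-other ε λ zc → v≢z (parent-unique vc zc))
    (trans (standardCode-standard v vc) (cong (λ x → (x + position (children v) c) % N)
      (sym (code-other ε λ zv → z-grandchildless zv (c , vc)))))

  code-siblings : ∀ {ε} → ε ≤ 1 → SiblingsDiffer (code ε)
  code-siblings {ε} ε≤1 {p} pu pv eq with p ≟ z
  ... | no p≢z = standard-siblings (code ε) (code-standard ε p≢z) pu pv eq
  ... | yes refl = position-injective (∈-children⁺ pu) (∈-children⁺ pv)
    (specialCode-injective ε≤1 (trans (sym (code-child ε pu)) (trans eq (code-child ε pv))))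

  children-z<N : length (children z) < N
  children-z<N = ≤-trans (children<degree z≢root) (degree≤N z)

  -- One value is skipped, so the codes of the children of `z` reach their number; that is still
  -- below `N`, since `z` is not the root.
  code< : ∀ {ε} → ε ≤ 1 → ∀ v → code ε v < N
  code< {ε} ε≤1 v with isParentOf? z v
  ... | no _ = standardCode< v
  ... | yes zv = special< (position (children z) v) (position<length (∈-children⁺ zv))
    where
    special< : ∀ i → i < length (children z) → specialCode ε i < N
    special< zero 0< = ≤-<-trans ε≤1 (≤-<-trans 0< children-z<N)
    special< (suc i) i< = ≤-<-trans i< children-z<N

  first-child : ∃[ w ] (w ∈ children z × position (children z) w ≡ 0)
  first-child = position-surjective (children-unique z)
    (≤-trans (s≤s z≤n) (position<length (∈-children⁺ (proj₂ z-bottom))))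

  w : Fin n
  w = proj₁ first-child

  zw : z isParentOf w
  zw = ∈-children⁻ (proj₁ (proj₂ first-child))

  w-leaf : ¬ Inner w
  w-leaf = z-grandchildless zw

  code-w : ∀ ε → code ε w ≡ ε
  code-w ε = trans (code-child ε zw) (cong (specialCode ε) (proj₂ (proj₂ first-child)))

  code-agree : ∀ {v} → v ≢ w → code 0 v ≡ code 1 v
  code-agree {v} v≢w with isParentOf? z v
  ... | no _ = refl
  ... | yes zv with position (children z) v in eq
  ...   | suc _ = refl
  ...   | zero = contradiction
    (position-injective (∈-children⁺ zv) (∈-children⁺ zw) (trans eq (sym (proj₂ (proj₂ first-child)))))
    v≢w

  upNeighbours-w : upNeighbours w ≡ z ∷ filter (w ~?_) (anc z)
  upNeighbours-w = trans (cong (filter (w ~?_)) zw) (filter-accept (w ~?_) (~-sym (parent⇒~ zw)))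

  -- The parent `z` comes first among the upper neighbours of `w`, so it receives the lowest digit,
  -- and the code `ε < b` has no other nonzero digit.
  digit-w : ∀ {ε a} → ε < b → a ≢ z → digitAt b (code ε w) (upNeighbours w) a ≡ digitAt b 0 (filter (w ~?_) (anc z)) a
  digit-w {ε} {a} ε<b a≢z = trans (cong₂ (λ q l → digitAt b q l a) (code-w ε) upNeighbours-w)
    (trans (digitAt-tail b ε _ (a≢z ∘ sym)) (cong (λ q → digitAt b q (filter (w ~?_) (anc z)) a) (m<n⇒m/n≡0 ε<b)))

  zw-colour : ∀ {ε} → ε < b → colour (code ε) z w ≡ suc ε
  zw-colour {ε} ε<b = trans (leaf-colour (code ε) w-leaf (subst (z ∈_) (sym zw) (here refl)))
    (cong suc (trans (cong₂ (λ q l → digitAt b q l z) (code-w ε) upNeighbours-w)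
      (trans (digitAt-head b ε z _) (m<n⇒m%n≡m ε<b))))

  downColour-agree : ∀ a v → ¬ (a ≡ z × v ≡ w) → downColour (code 0) a v ≡ downColour (code 1) a v
  downColour-agree a v ≢zw with Inner? v
  ... | yes _ = refl
  ... | no _ with v ≟ w
  ...   | no v≢w = cong (λ q → suc (digitAt b q (upNeighbours v) a)) (code-agree v≢w)
  ...   | yes refl = cong suc (trans (digit-w (<-trans (s≤s z≤n) 1<b) a≢z) (sym (digit-w 1<b a≢z)))
    where
    a≢z : a ≢ z
    a≢z a≡z = ≢zw (a≡z , refl)

  colour-agree : ∀ u v → ¬ (u ≡ z × v ≡ w) → ¬ (v ≡ z × u ≡ w) → colour (code 0) u v ≡ colour (code 1) u v
  colour-agree u v ≢zw ≢wz with depth u <? depth v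
  ... | yes _ = downColour-agree u v ≢zw
  ... | no  _ = downColour-agree v u ≢wz

  ones-root : ones (code 0) root ≡ ones (code 1) root
  ones-root = filter-≐ _ _
    ((λ { {x} (e , one) → e , trans (sym (agree x)) one }) , (λ { {x} (e , one) → e , trans (agree x) one }))
    (allFin n)
    where
    agree : ∀ x → colour (code 0) root x ≡ colour (code 1) root x
    agree x = colour-agree root x (λ (r≡z , _) → z≢root (sym r≡z))
      λ (_ , r≡w) → root-no-parent (subst (z isParentOf_) (sym r≡w) zw)

  -- The edge from `z` to `w` has colour 1 under `code 0` and colour 2 under `code 1`; no other edge
  -- changes.
  ones-z : length (ones (code 1) z) < length (ones (code 0) z)
  ones-z = Unique-⊆⇒length≤ {ys = ones (code 0) z}
    (∉⇒All≢ (w≢one ∘ ∈-ones) ∷ Unique.filter⁺ _ (Unique.allFin⁺ n)) λ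
    { (here refl) → ∈-filter⁺ _ (∈-allFin w) (parent⇒~ zw , zw-colour (<-trans (s≤s z≤n) 1<b))
    ; {x} (there x∈) → let e , one = ∈-ones x∈ in
        ∈-filter⁺ _ (∈-allFin x) (e , trans
          (colour-agree z x (λ { (_ , refl) → w≢one (e , one) }) (λ { (refl , _) → ~-irrefl z e })) one) }
    where
    ∈-ones : ∀ {x} → x ∈ ones (code 1) z → z ~ x × colour (code 1) z x ≡ 1
    ∈-ones x∈ = proj₂ (∈-filter⁻ (λ x → (z ~? x) ×-dec (colour (code 1) z x ℕ.≟ 1)) {xs = allFin n} x∈)

    w≢one : ¬ (z ~ w × colour (code 1) z w ≡ 1)
    w≢one (_ , one) with () ← trans (sym (zw-colour 1<b)) one

  -- Once the root is fixed, `f z` is inner and as deep as `z`, so without a rival `z` is fixed. All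
  -- other vertices are standard, and so are their images.
  rigid-special : ¬ ∃ Rival → ∀ {ε} → ε ≤ 1 → length (ones (code ε) root) ≢ length (ones (code ε) z) →
    Rigid G (colour (code ε))
  rigid-special no-rival {ε} ε≤1 unbalanced = rigid (code ε) (code< ε≤1) (code-siblings ε≤1)
    (unbalanced⇒root-fixed (code ε) unbalanced) fixed-or-standard
    where
    z-fixed : ∀ {f g} → ColourAut G (colour (code ε)) f g → f root ≡ root → f z ≡ z
    z-fixed {f} φ fr = decidable-stable (f z ≟ z) λ fz≢z → no-rival
      (f z , fz≢z , image-inner (code ε) φ fr z-inner , image-depth-inner (code ε) φ fr z z-inner)

    fixed-or-standard : ∀ {f g} → ColourAut G (colour (code ε)) f g → f root ≡ root →
      ∀ v → v ≢ root → f v ≡ v ⊎ (Standard (code ε) v × Standard (code ε) (f v))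
    fixed-or-standard {f} φ fr v _ with v ≟ z
    ... | yes refl = inj₁ (z-fixed φ fr)
    ... | no v≢z = inj₂ (code-standard ε v≢z , code-standard ε λ fv≡z →
      v≢z (f-injective (code ε) φ (trans fv≡z (sym (z-fixed φ fr)))))

  -- A rival forces the root to be fixed under the standard codes; otherwise the children of `z` are
  -- recoded.
  rigid-colouring : Σ[ c ∈ (Fin n → ℕ) ] Rigid G (colour c)
  rigid-colouring with any? (λ y → ¬? (y ≟ z) ×-dec Inner? y ×-dec (depth y ℕ.≟ depth z))
  ... | yes (y , rival) = standardCode , rigid standardCode standardCode<
    (standard-siblings standardCode (standardCode-standard _))
    (rival⇒root-fixed rival standardCode)
    λ {f} _ _ v _ → inj₂ (standardCode-standard v , standardCode-standard (f v))
  ... | no no-rival with length (ones (code 0) root) ℕ.≟ length (ones (code 0) z)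
  ...   | no unbalanced = code 0 , rigid-special no-rival z≤n unbalanced
  -- From `code 0` to `code 1` the count at `z` drops while the count at the root stays, so both
  -- cannot be balanced.
  ...   | yes balanced = code 1 , rigid-special no-rival (s≤s z≤n) λ balanced′ →
    <-irrefl (trans (sym balanced′) (trans (cong length (sym ones-root)) balanced)) ones-z

-- The bound on the distinguishing index

module _ {n : ℕ} (G : Graph n) {δ : ℕ} (connected : Connected G) (1<δ : 1 < δ)
         (δ≤degree : ∀ v → δ ≤ degree G v) (v₀ : Fin n) where
  open Graph G

  rigid-labeling : ∀ {k} → 1 < k → (∀ v → degree G v ≤ k ^ δ) → Σ[ c ∈ EdgeLabeling G (suc k) ] Distinguishing G c
  rigid-labeling {k@(suc _)} 1<k degree≤
    -- The longest path found here becomes the root path of `u`, with its other end as the root.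
    with u , us , path , longest ← longest-path G v₀
    with r , anc , T , anc-u ← normal-tree G connected u us path =
    fromColouring G bounded
      (λ u v e → toℕ-injective
        (trans (toℕ-bounded u v) (trans (colour-sym code u v e) (sym (toℕ-bounded v u)))))
      λ f g φ → rigid f g (ColourAut-recolour G
        (λ {u} {v} {u′} {v′} eq → trans (sym (toℕ-bounded u v)) (trans (cong toℕ eq) (toℕ-bounded u′ v′))) φ)
    where
    open Colouring G T k
    instance
      N≢0 : NonZero (k ^ δ)
      N≢0 = m^n≢0 k δ

    existence : Σ[ c ∈ (Fin n → ℕ) ] Rigid G (colour c)
    existence = Existence.rigid-colouring G T k δ δ≤degree degree≤ 1<k 1<δ u
      (subst (λ l → ∀ xs → Path G xs → length xs ≤ suc (length l)) (sym anc-u) longest)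

    code = proj₁ existence
    rigid = proj₂ existence

    bounded : Fin n → Fin n → Fin (suc k)
    bounded u v = fromℕ< (colour≤base code u v)

    toℕ-bounded : ∀ u v → toℕ (bounded u v) ≡ colour code u v
    toℕ-bounded u v = toℕ-fromℕ< (colour≤base code u v)

-- Powers of 0 and 1 with positive exponent are at most 1. A base above 1 is what gives the codes 0
-- and 1 different lowest digits.
1<root : ∀ {δ Δ k} → 1 < δ → 1 < Δ → Δ ≤ k ^ δ → 1 < k
1<root {suc δ} {k = zero} 1<δ 1<Δ Δ≤ = contradiction (≤-trans 1<Δ Δ≤) λ ()
1<root {suc δ} {k = suc zero} 1<δ 1<Δ Δ≤ = contradiction (subst (1 <_) (^-zeroˡ (suc δ)) (≤-trans 1<Δ Δ≤)) (<-irrefl refl)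
1<root {k = suc (suc _)} _ _ _ = s≤s (s≤s z≤n)

theorem2p3 : ∀ {n : ℕ} (G : Graph n) {δ Δ : ℕ} →
    Connected G → IsMinDegree G δ → IsMaxDegree G Δ → 2 ≤ δ →
    ∃[ D′ ] ∃[ k ] (IsDistinguishingIndex G D′ × IsCeilRoot δ Δ k × D′ ≤ k + 1)
theorem2p3 {n} G {δ} {Δ} connected ((v₀ , _) , δ-least) (_ , Δ-greatest) 2≤δ =
  -- The search for the rounded root is bounded by `Δ`, as `Δ ≤ Δ ^ δ`.
  let k , ceil , _ = least-below (λ k → Δ ≤? k ^ δ) Δ≤Δ^δ
      labeling = rigid-labeling G connected 2≤δ δ≤degree v₀ (1<root {δ} 2≤δ 1<Δ (proj₁ ceil))
                   λ v → ≤-trans (degree≤Δ v) (proj₁ ceil)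
      D′ , index , D′≤ = least-below (Distinguishable? G (proj₂ neighbour)) labeling
  in D′ , k , index , ceil , subst (D′ ≤_) (+-comm 1 k) D′≤
  where
  open Graph G

  δ≤degree : ∀ v → δ ≤ degree G v
  δ≤degree v = δ-least (degree G v) (v , refl)

  degree≤Δ : ∀ v → degree G v ≤ Δ
  degree≤Δ v = Δ-greatest (degree G v) (v , refl)

  1<Δ : 1 < Δ
  1<Δ = ≤-trans 2≤δ (≤-trans (δ≤degree v₀) (degree≤Δ v₀))

  Δ≤Δ^δ : Δ ≤ Δ ^ δ
  Δ≤Δ^δ = subst (_≤ Δ ^ δ) (^-identityʳ Δ) (^-monoʳ-≤ Δ {{>-nonZero (<-trans (s≤s z≤n) 1<Δ)}} (<⇒≤ 2≤δ))

  neighbour : ∃[ x ] v₀ ~ x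
  neighbour with any? (v₀ ~?_)
  ... | yes e = e
  ... | no ¬e = contradiction
    (≤-trans (≤-trans (<⇒≤ 2≤δ) (δ≤degree v₀)) (≤-reflexive (cong length
      (filter-none (v₀ ~?_) (All.tabulate {xs = allFin n} λ {x} _ e → ¬e (x , e))))))
    λ ()
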